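{- Let $d \ge 1$ be an integer. Every $d$-dimensional $2$-level polytope $P$ satisfies $f_0(P)\, f_{d-1}(P) \le d\, 2^{d+1}$.
   Context: A polytope is the convex hull of a finite set of points in a Euclidean space; its dimension is the dimension of its affine hull. A polytope $P$ is called $2$-level if for every facet-defining hyperplane $H$ of $P$ there is a hyperplane $H'$ parallel to $H$ such that $H \cup H'$ contains all vertices of $P$. (For a $d$-dimensional polytope one may take the ambient space to be $\mathbb{R}^d$.) $f_0(P)$ denotes the number of vertices of $P$, and $f_{d-1}(P)$ denotes the number of facets (that is, $(d-1)$-dimensional faces) of $P$. -}

module Defs where

open import Algebra.Bundles using (CommutativeRing)
open import Data.Fin.Base using (Fin)
open import Data.Nat.Base using (ℕ; suc; _∸_)
open import Data.Product.Base using (Σ; ∃; ∃-syntax; _×_; proj₁)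
open import Data.Vec.Functional using (Vector)
open import Function.Bundles using (Bijection)
open import Level using (Level; _⊔_) renaming (suc to lsuc)
open import Relation.Binary.Bundles using (Setoid)
open import Relation.Binary.PropositionalEquality using (setoid)
import Relation.Binary.Construct.On as On
open import Relation.Binary.Core using (Rel)
open import Relation.Binary.Structures using (IsDecTotalOrder)
open import Relation.Nullary.Negation.Core using (¬_)
open import Relation.Unary using (Pred; Satisfiable; _⊆_; _≐_; _∩_; _∪_)
open import Relation.Unary.Relation.Binary.Equality using (≐-setoid)
import Algebra.Properties.CommutativeMonoid.Sum as Sum
import Data.Vec.Functional.Relation.Binary.Equality.Setoid as VectorEquality

-- The field ℝ, axiomatised as a Dedekind-complete ordered field, which
-- classically determines it up to isomorphism.  As in classical analysis the
-- order is decidable and every nonempty bounded-above subset has a supremum.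
record RealField (c ℓ₁ ℓ₂ : Level) : Set (lsuc (c ⊔ ℓ₁ ⊔ ℓ₂)) where
  field
    commutativeRing : CommutativeRing c ℓ₁

  open CommutativeRing commutativeRing public

  infix 4 _≤_

  field
    _≤_             : Rel Carrier ℓ₂
    isDecTotalOrder : IsDecTotalOrder _≈_ _≤_
    1≉0             : ¬ (1# ≈ 0#)
    inverse         : ∀ x → ¬ (x ≈ 0#) → ∃[ y ] x * y ≈ 1#
    +-monoʳ-≤       : ∀ x {y z} → y ≤ z → x + y ≤ x + z
    *-nonNegative   : ∀ {x y} → 0# ≤ x → 0# ≤ y → 0# ≤ x * y

  UpperBound : Pred Carrier (c ⊔ ℓ₁ ⊔ ℓ₂) → Pred Carrier (c ⊔ ℓ₁ ⊔ ℓ₂)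
  UpperBound S u = ∀ x → S x → x ≤ u

  field
    supremum : ∀ S → Satisfiable S → Satisfiable (UpperBound S) →
               ∃[ s ] UpperBound S s × (∀ u → UpperBound S u → s ≤ u)

module Polytopes {c ℓ₁ ℓ₂ : Level} (ℝ : RealField c ℓ₁ ℓ₂) where

  open RealField ℝ hiding (setoid)
  open Sum +-commutativeMonoid using (sum)
  open VectorEquality (RealField.setoid ℝ) using (_≋_; ≋-setoid)

  Point : ℕ → Set c
  Point n = Vector Carrier n

  Subset : ℕ → Set (lsuc (c ⊔ ℓ₁ ⊔ ℓ₂))
  Subset n = Pred (Point n) (c ⊔ ℓ₁ ⊔ ℓ₂)

  infixl 8 _·_

  _·_ : ∀ {n} → Point n → Point n → Carrier
  a · x = sum (λ i → a i * x i)

  0ᵛ : ∀ {n} → Point n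
  0ᵛ _ = 0#

  combination : ∀ {n m} → Vector Carrier m → Vector (Point n) m → Point n
  combination w p j = sum (λ i → w i * p i j)

  convexHull : ∀ {n m} → Vector (Point n) m → Pred (Point n) (c ⊔ ℓ₁ ⊔ ℓ₂)
  convexHull p x =
    ∃[ w ] (∀ i → 0# ≤ w i) × sum w ≈ 1# × combination w p ≋ x

  affineSpan : ∀ {n m} → Vector (Point n) m → Pred (Point n) (c ⊔ ℓ₁)
  affineSpan p x = ∃[ w ] sum w ≈ 1# × combination w p ≋ x

  affineHull : ∀ {n} → Subset n → Subset n
  affineHull {n} S x =
    ∃[ m ] Σ (Vector (Point n) m) λ p → (∀ i → S (p i)) × affineSpan p x

  AffinelyIndependent : ∀ {n m} → Vector (Point n) m → Set (c ⊔ ℓ₁)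
  AffinelyIndependent p =
    ∀ w → sum w ≈ 0# → combination w p ≋ 0ᵛ → ∀ i → w i ≈ 0#

  -- The empty set (of dimension -1) has no dimension in this sense.
  HasDimension : ∀ {n} → Subset n → ℕ → Set (c ⊔ ℓ₁ ⊔ ℓ₂)
  HasDimension {n} S k =
    Σ (Vector (Point n) (suc k)) λ b →
      AffinelyIndependent b × affineHull S ≐ affineSpan b

  IsPolytope : ∀ {n} → Subset n → Set (c ⊔ ℓ₁ ⊔ ℓ₂)
  IsPolytope {n} P = ∃[ m ] Σ (Vector (Point n) m) λ p → P ≐ convexHull p

  level : ∀ {n} → Point n → Carrier → Pred (Point n) ℓ₁
  level a β x = a · x ≈ β

  -- With a = 0 this includes P itself and the empty set.
  IsFace : ∀ {n ℓ} → Subset n → Pred (Point n) ℓ → Set (c ⊔ ℓ₁ ⊔ ℓ₂ ⊔ ℓ)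
  IsFace P F =
    ∃[ a ] ∃[ β ] (∀ x → P x → a · x ≤ β) × F ≐ (P ∩ level a β)

  IsVertex : ∀ {n} → Subset n → Pred (Point n) (c ⊔ ℓ₁ ⊔ ℓ₂)
  IsVertex P v = IsFace P (v ≋_)

  -- The argument d is meant to be the dimension of P, with d ≥ 1.
  IsFacet : ∀ {n} → ℕ → Subset n → Pred (Subset n) (c ⊔ ℓ₁ ⊔ ℓ₂)
  IsFacet d P F = IsFace P F × HasDimension F (d ∸ 1)

  record Hyperplane (n : ℕ) : Set (c ⊔ ℓ₁) where
    field
      normal  : Point n
      offset  : Carrier
      nonzero : ¬ (normal ≋ 0ᵛ)

  open Hyperplane

  ⟦_⟧ : ∀ {n} → Hyperplane n → Pred (Point n) ℓ₁
  ⟦ H ⟧ = level (normal H) (offset H)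

  Parallel : ∀ {n} → Rel (Hyperplane n) (c ⊔ ℓ₁)
  Parallel H H′ = ∃[ t ] normal H′ ≋ (λ i → t * normal H i)

  FacetDefining : ∀ {n} → ℕ → Subset n → Pred (Hyperplane n) (c ⊔ ℓ₁ ⊔ ℓ₂)
  FacetDefining d P H = IsFacet d P (P ∩ ⟦ H ⟧)

  TwoLevel : ∀ {n} → ℕ → Subset n → Set (c ⊔ ℓ₁ ⊔ ℓ₂)
  TwoLevel d P =
    ∀ H → FacetDefining d P H →
    ∃[ H′ ] Parallel H H′ × IsVertex P ⊆ (⟦ H ⟧ ∪ ⟦ H′ ⟧)

  Vertices : ∀ {n} → Subset n → Setoid (c ⊔ ℓ₁ ⊔ ℓ₂) ℓ₁
  Vertices {n} P = On.setoid {B = ∃ (IsVertex P)} (≋-setoid n) proj₁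

  Facets : ∀ {n} → ℕ → Subset n →
           Setoid (lsuc (c ⊔ ℓ₁ ⊔ ℓ₂)) (c ⊔ ℓ₁ ⊔ ℓ₂)
  Facets {n} d P =
    On.setoid {B = ∃ (IsFacet d P)} (≐-setoid (Point n) (c ⊔ ℓ₁ ⊔ ℓ₂)) proj₁

  HasCardinality : ∀ {a ℓ} → Setoid a ℓ → ℕ → Set (a ⊔ ℓ)
  HasCardinality S k = Bijection (setoid (Fin k)) S

{-# OPTIONS --safe #-}
module Submission where

open import Algebra.Solver.Ring.AlmostCommutativeRing
  using (fromCommutativeRing; _-Raw-AlmostCommutative⟶_; Induced-equivalence)
import Algebra.Properties.AbelianGroup as AbelianGroupProperties
import Algebra.Properties.Ring as RingProperties
import Algebra.Properties.Semiring.Mult.TCOptimised as SemiringMult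
import Algebra.Properties.Semiring.Sum as SemiringSum
import Algebra.Solver.Ring as RingSolver
open import Data.Bool.Base using (Bool; true; false; not)
import Data.Bool.Properties as Bool
open import Data.Fin.Base using (Fin; zero; suc; punchIn; punchOut)
open import Data.Fin.Properties using (any?; punchIn-punchOut) renaming (_≟_ to _≟ᶠ_)
open import Data.Integer.Base as ℤ using (ℤ; +_; -[1+_]; _⊖_)
import Data.Integer.Properties as ℤ
open import Data.List.Base using (List; []; _∷_; _++_; length; filter; tabulate; allFin)
import Data.List.Extrema as Extrema
open import Data.List.Membership.Propositional using (_∈_; find; lose)
open import Data.List.Membership.Propositional.Properties
  using (∈-filter⁺; ∈-filter⁻; ∈-++⁻; ∈-allFin; ∈-tabulate⁻)
open import Data.List.Properties using (filter-notAll; length-filter; length-++; length-tabulate)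
open import Data.List.Relation.Unary.All as All using (All; []; _∷_)
import Data.List.Relation.Unary.All.Properties as All
open import Data.List.Relation.Unary.AllPairs using (AllPairs; []; _∷_)
import Data.List.Relation.Unary.AllPairs.Properties as AllPairs
open import Data.List.Relation.Unary.Any as Any using (Any; here; there)
import Data.Maybe.Base as Maybe
open import Data.Nat.Base as ℕ using (ℕ; zero; suc)
import Data.Nat.Properties as ℕ
open import Data.Nat.Solver using (module +-*-Solver)
open import Data.Product.Base using (_×_; _,_; proj₁; proj₂; ∃; ∃-syntax; Σ-syntax)
open import Data.Sum.Base using (_⊎_; inj₁; inj₂)
open import Data.Unit.Polymorphic.Base using (⊤; tt)
open import Data.Vec.Functional using (Vector; head; tail) renaming ([] to []ᵛ; _∷_ to _∷ᵛ_)
import Data.Vec.Functional.Relation.Binary.Equality.Setoid as VectorEquality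
open import Function.Base using (_∘_; id)
open import Function.Bundles using (Bijection)
open import Level using (Level; _⊔_)
open import Relation.Binary.Bundles using (DecTotalOrder)
open import Relation.Binary.Core using (Rel)
open import Relation.Binary.Definitions using (WeaklyDecidable)
open import Relation.Binary.PropositionalEquality as ≡ using (_≡_; _≢_)
open import Relation.Nullary using (¬_; ¬?; Dec; yes; no; does; contradiction)
open import Relation.Nullary.Decidable using (dec⇒maybe; decidable-stable)
open import Relation.Unary using (Pred; Decidable; _≐_; _∩_; _∪_; _⊆_)
open import Defs

-- Homogenise, so that affine functions on ℝᵈ are linear functionals on ℝᵈ⁺¹, and let S be
-- the vertex set. In a 2-level polytope every facet is the zero set of a unique
-- functional with values 0 and 1 on S.
--
-- Kupavskii and Weltge's bound: |S| |L| ≤ r 2ʳ for any set L of 0/1-valued functionals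
-- on a two-level set S of rank r. Take a facet f whose zero set S₀ ⊆ S is as large as possible,
-- and S₁ = S ∖ S₀, so that |S₁| ≤ |S₀|. A functional is determined on S by its restriction to
-- S₀ and its value at a single point of S₁. Hence |L| = l + δ, where l is the number of
-- restrictions to S₀ and δ ≤ l the number of those that extend in two ways. The
-- latter extend to functionals that are constant on S₁, so 2 |S₁| δ ≤ 2ʳ by counting
-- dimensions, while |S₀| l ≤ (r − 1) 2ʳ⁻¹ by induction. By the rearrangement inequality
-- |S| |L| = (|S₀| + |S₁|)(l + δ) ≤ 2 (|S₀| l + |S₁| δ) ≤ r 2ʳ.
--
-- If no two facets are parallel and opposite, apply this in rank d + 1 to the facet functionals
-- f together with their complements 1 − f. If f and 1 − f are both facets, the larger of them
-- contains at least half of the vertices, and all facet functionals stay distinct on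
-- it, so the bound in rank d suffices.
--
-- Large facets come from extremal choices in undecidable families. These are made under
-- double negation, which is harmless because the inequality is decidable.

-- No face is treated as a polytope in its own right: the induction runs over sublists S of the
-- vertices, always with functionals on the one space ℝᵈ⁺¹. So a facet of S is itself a functional,
-- one that its zeros determine on S up to a factor, and rank is measured by chains of points with
-- witnessing functionals. The price is that a facet of S₀ must be extended to a facet of S before
-- two-levelness of S applies to it. The zeros are maximised over all functionals that are
-- nonnegative and not zero on S, not only over facets. Hence 1 - f competes with f, and since its
-- zeros are S₁, this gives |S₁| ≤ |S₀|. A maximiser is a facet because otherwise it could be
-- rotated to gain zeros. The factor 2 in 2 |S₁| δ ≤ 2ʳ is due to the constant functional 1: points
-- told apart by 0/1 functionals contain k independent ones with |S₁| ≤ 2ᵏ⁻¹, and at most 2ʳ⁻ᵏ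
-- functionals agree on these. Both cases lead to the same constant: (d + 1) 2ᵈ ≤ d 2ᵈ⁺¹ without
-- opposite facets, and 2 · d 2ᵈ with them. The cube attains it, with 2ᵈ vertices and 2d facets.

-- Arithmetic in an ordered field

module OrderedField {c ℓ₁ ℓ₂} (ℝ : RealField c ℓ₁ ℓ₂) where

  open RealField ℝ hiding (zero)
  open AbelianGroupProperties +-abelianGroup
    using (⁻¹-∙-comm; ⁻¹-involutive; ε⁻¹≈ε; xyx⁻¹≈y)
  open RingProperties ring using (-‿distribˡ-*; -‿distribʳ-*)
  open SemiringMult semiring using (1+×; ×-homo-+; ×1-homo-*) renaming (_×_ to _⋆_)
  open import Relation.Binary.Reasoning.Setoid (RealField.setoid ℝ)

  private
    ⟦_⟧ᶻ : ℤ → Carrier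
    ⟦ + n ⟧ᶻ      = n ⋆ 1#
    ⟦ -[1+ n ] ⟧ᶻ = - (suc n ⋆ 1#)

    ⊖-homo : ∀ m n → ⟦ m ⊖ n ⟧ᶻ ≈ m ⋆ 1# - n ⋆ 1#
    ⊖-homo zero zero       = sym (-‿inverseʳ 0#)
    ⊖-homo zero (suc n)    = sym (+-identityˡ _)
    ⊖-homo (suc m) zero    = sym (trans (+-congˡ ε⁻¹≈ε) (+-identityʳ _))
    ⊖-homo (suc m) (suc n) = begin
      ⟦ suc m ⊖ suc n ⟧ᶻ                    ≡⟨ ≡.cong ⟦_⟧ᶻ (ℤ.[1+m]⊖[1+n]≡m⊖n m n) ⟩
      ⟦ m ⊖ n ⟧ᶻ                            ≈⟨ ⊖-homo m n ⟩
      a - b                                 ≈⟨ +-congʳ (xyx⁻¹≈y 1# a) ⟨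
      (1# + a - 1#) - b                     ≈⟨ +-assoc _ _ _ ⟩
      (1# + a) + (- 1# + - b)               ≈⟨ +-congˡ (⁻¹-∙-comm 1# b) ⟩
      (1# + a) - (1# + b)                   ≈⟨ +-cong (1+× m 1#) (-‿cong (1+× n 1#)) ⟨
      suc m ⋆ 1# - suc n ⋆ 1#               ∎
      where
      a = m ⋆ 1#
      b = n ⋆ 1#

    +-homo : ∀ i j → ⟦ i ℤ.+ j ⟧ᶻ ≈ ⟦ i ⟧ᶻ + ⟦ j ⟧ᶻ
    +-homo (+ m) (+ n)           = ×-homo-+ 1# m n
    +-homo (+ m) -[1+ n ]        = ⊖-homo m (suc n)
    +-homo -[1+ m ] (+ n)        = trans (⊖-homo n (suc m)) (+-comm _ _)
    +-homo -[1+ m ] -[1+ n ]     = begin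
      - (suc (suc (m ℕ.+ n)) ⋆ 1#)          ≡⟨ ≡.cong (λ k → - (k ⋆ 1#)) (≡.cong suc (ℕ.+-suc m n)) ⟨
      - ((suc m ℕ.+ suc n) ⋆ 1#)            ≈⟨ -‿cong (×-homo-+ 1# (suc m) (suc n)) ⟩
      - (suc m ⋆ 1# + suc n ⋆ 1#)           ≈⟨ ⁻¹-∙-comm _ _ ⟨
      - (suc m ⋆ 1#) + - (suc n ⋆ 1#)       ∎

    -‿homo : ∀ i → ⟦ ℤ.- i ⟧ᶻ ≈ - ⟦ i ⟧ᶻ
    -‿homo (+ zero)  = sym ε⁻¹≈ε
    -‿homo (+ suc n) = refl
    -‿homo -[1+ n ]  = sym (⁻¹-involutive _)

    +*-homo : ∀ m j → ⟦ + m ℤ.* j ⟧ᶻ ≈ m ⋆ 1# * ⟦ j ⟧ᶻ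
    +*-homo m (+ n)    = trans (reflexive (≡.cong ⟦_⟧ᶻ (≡.sym (ℤ.pos-* m n)))) (×1-homo-* m n)
    +*-homo m -[1+ n ] = begin
      ⟦ + m ℤ.* -[1+ n ] ⟧ᶻ        ≡⟨ ≡.cong ⟦_⟧ᶻ (ℤ.neg-distribʳ-* (+ m) (+ suc n)) ⟨
      ⟦ ℤ.- (+ m ℤ.* + suc n) ⟧ᶻ   ≈⟨ -‿homo (+ m ℤ.* + suc n) ⟩
      - ⟦ + m ℤ.* + suc n ⟧ᶻ       ≈⟨ -‿cong (+*-homo m (+ suc n)) ⟩
      - (m ⋆ 1# * suc n ⋆ 1#)      ≈⟨ -‿distribʳ-* _ _ ⟩
      m ⋆ 1# * - (suc n ⋆ 1#)      ∎

    *-homo : ∀ i j → ⟦ i ℤ.* j ⟧ᶻ ≈ ⟦ i ⟧ᶻ * ⟦ j ⟧ᶻ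
    *-homo (+ m) j    = +*-homo m j
    *-homo -[1+ m ] j = begin
      ⟦ -[1+ m ] ℤ.* j ⟧ᶻ          ≡⟨ ≡.cong ⟦_⟧ᶻ (ℤ.neg-distribˡ-* (+ suc m) j) ⟨
      ⟦ ℤ.- (+ suc m ℤ.* j) ⟧ᶻ     ≈⟨ -‿homo (+ suc m ℤ.* j) ⟩
      - ⟦ + suc m ℤ.* j ⟧ᶻ         ≈⟨ -‿cong (+*-homo (suc m) j) ⟩
      - (suc m ⋆ 1# * ⟦ j ⟧ᶻ)      ≈⟨ -‿distribˡ-* _ _ ⟩
      - (suc m ⋆ 1#) * ⟦ j ⟧ᶻ      ∎

    -- The solver takes its coefficients from ℤ because equality of integers computes. Equality in
    -- the field is decided by an axiom, so cancelling constants would not be recognised there.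
    fromℤ : ℤ.+-*-rawRing -Raw-AlmostCommutative⟶ fromCommutativeRing commutativeRing
    fromℤ = record
      { ⟦_⟧    = ⟦_⟧ᶻ
      ; +-homo = +-homo
      ; *-homo = *-homo
      ; -‿homo = -‿homo
      ; 0-homo = refl
      ; 1-homo = refl
      }

    ⟦⟧-≟ : WeaklyDecidable (Induced-equivalence fromℤ)
    ⟦⟧-≟ i j = Maybe.map (reflexive ∘ ≡.cong ⟦_⟧ᶻ) (dec⇒maybe (i ℤ.≟ j))

  module Solver = RingSolver ℤ.+-*-rawRing (fromCommutativeRing commutativeRing) fromℤ ⟦⟧-≟

  open Solver using (solve; _:=_; _:+_; _:*_; _:-_; :-_)

  decTotalOrder : DecTotalOrder c ℓ₁ ℓ₂
  decTotalOrder = record { isDecTotalOrder = isDecTotalOrder }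

  open DecTotalOrder decTotalOrder public
    using (_≟_; _≤?_; totalOrder; ≤-respˡ-≈; ≤-respʳ-≈)
    renaming (refl to ≤-refl; reflexive to ≤-reflexive; trans to ≤-trans;
              total to ≤-total; antisym to ≤-antisym)

  x≤y⇒0≤y-x : ∀ {x y} → x ≤ y → 0# ≤ y - x
  x≤y⇒0≤y-x {x} {y} x≤y = ≤-respˡ-≈ (-‿inverseˡ x)
    (≤-respʳ-≈ (+-comm (- x) y) (+-monoʳ-≤ (- x) x≤y))

  0≤y-x⇒x≤y : ∀ {x y} → 0# ≤ y - x → x ≤ y
  0≤y-x⇒x≤y {x} {y} 0≤y-x = ≤-respˡ-≈ (+-identityʳ x)
    (≤-respʳ-≈ (solve 2 (λ x y → x :+ (y :- x) := y) refl x y) (+-monoʳ-≤ x 0≤y-x))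

  x≤0⇒0≤-x : ∀ {x} → x ≤ 0# → 0# ≤ - x
  x≤0⇒0≤-x x≤0 = ≤-respʳ-≈ (+-identityˡ _) (x≤y⇒0≤y-x x≤0)

  0≤-x⇒x≤0 : ∀ {x} → 0# ≤ - x → x ≤ 0#
  0≤-x⇒x≤0 0≤-x = 0≤y-x⇒x≤y (≤-respʳ-≈ (sym (+-identityˡ _)) 0≤-x)

  +-nonNegative : ∀ {x y} → 0# ≤ x → 0# ≤ y → 0# ≤ x + y
  +-nonNegative {x} 0≤x 0≤y = ≤-trans 0≤x (≤-respˡ-≈ (+-identityʳ x) (+-monoʳ-≤ x 0≤y))

  x+y≈0⇒x≈0 : ∀ {x y} → 0# ≤ x → 0# ≤ y → x + y ≈ 0# → x ≈ 0#
  x+y≈0⇒x≈0 {x} 0≤x 0≤y x+y≈0 = ≤-antisym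
    (≤-respˡ-≈ (+-identityʳ x) (≤-respʳ-≈ x+y≈0 (+-monoʳ-≤ x 0≤y))) 0≤x

  x+y≈0⇒y≈0 : ∀ {x y} → 0# ≤ x → 0# ≤ y → x + y ≈ 0# → y ≈ 0#
  x+y≈0⇒y≈0 0≤x 0≤y x+y≈0 = x+y≈0⇒x≈0 0≤y 0≤x (trans (+-comm _ _) x+y≈0)

  square-nonNegative : ∀ x → 0# ≤ x * x
  square-nonNegative x with ≤-total 0# x
  ... | inj₁ 0≤x = *-nonNegative 0≤x 0≤x
  ... | inj₂ x≤0 = ≤-respʳ-≈ (solve 1 (λ x → :- x :* :- x := x :* x) refl x)
    (*-nonNegative (x≤0⇒0≤-x x≤0) (x≤0⇒0≤-x x≤0))

  0≤1 : 0# ≤ 1#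
  0≤1 = ≤-respʳ-≈ (*-identityˡ 1#) (square-nonNegative 1#)

  inv : Carrier → Carrier
  inv x with x ≟ 0#
  -- A default value that makes `inv` total; the laws about `inv` assume a nonzero argument.
  ... | yes _  = 0#
  ... | no x≉0 = proj₁ (inverse x x≉0)

  *-inverseʳ : ∀ {x} → ¬ x ≈ 0# → x * inv x ≈ 1#
  *-inverseʳ {x} x≉0 with x ≟ 0#
  ... | yes x≈0 = contradiction x≈0 x≉0
  ... | no x≉0′ = proj₂ (inverse x x≉0′)

  inv-nonNegative : ∀ {x} → 0# ≤ x → ¬ x ≈ 0# → 0# ≤ inv x
  inv-nonNegative {x} 0≤x x≉0 = ≤-respʳ-≈
    (trans (sym (*-assoc x (inv x) (inv x))) (trans (*-congʳ (*-inverseʳ x≉0)) (*-identityˡ _)))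
    (*-nonNegative 0≤x (square-nonNegative (inv x)))

  *-cancelˡ : ∀ {x y z} → ¬ x ≈ 0# → x * y ≈ x * z → y ≈ z
  *-cancelˡ {x} {y} {z} x≉0 xy≈xz = begin
    y                 ≈⟨ *-identityʳ y ⟨
    y * 1#            ≈⟨ *-congˡ (*-inverseʳ x≉0) ⟨
    y * (x * inv x)   ≈⟨ swap y ⟩
    x * y * inv x     ≈⟨ *-congʳ xy≈xz ⟩
    x * z * inv x     ≈⟨ swap z ⟨
    z * (x * inv x)   ≈⟨ *-congˡ (*-inverseʳ x≉0) ⟩
    z * 1#            ≈⟨ *-identityʳ z ⟩
    z                 ∎
    where
    swap : ∀ w → w * (x * inv x) ≈ x * w * inv x
    swap w = solve 3 (λ w x i → w :* (x :* i) := x :* w :* i) refl w x (inv x)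

  xy≈0⇒y≈0 : ∀ {x y} → ¬ x ≈ 0# → x * y ≈ 0# → y ≈ 0#
  xy≈0⇒y≈0 {x} x≉0 xy≈0 = *-cancelˡ x≉0 (trans xy≈0 (sym (zeroʳ x)))

  *-nonZero : ∀ {x y} → ¬ x ≈ 0# → ¬ y ≈ 0# → ¬ x * y ≈ 0#
  *-nonZero x≉0 y≉0 xy≈0 = y≉0 (xy≈0⇒y≈0 x≉0 xy≈0)

  -‿nonZero : ∀ {x} → ¬ x ≈ 0# → ¬ - x ≈ 0#
  -‿nonZero x≉0 -x≈0 = x≉0 (trans (sym (⁻¹-involutive _)) (trans (-‿cong -x≈0) ε⁻¹≈ε))

  open SemiringSum semiring

  sum-nonNegative : ∀ {n} {w : Fin n → Carrier} → (∀ i → 0# ≤ w i) → 0# ≤ sum w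
  sum-nonNegative {zero}  0≤w = ≤-refl
  sum-nonNegative {suc n} 0≤w = +-nonNegative (0≤w zero) (sum-nonNegative (0≤w ∘ suc))

  sum≈0⇒≈0 : ∀ {n} {w : Fin n → Carrier} → (∀ i → 0# ≤ w i) → sum w ≈ 0# → ∀ i → w i ≈ 0#
  sum≈0⇒≈0 0≤w ∑≈0 zero    = x+y≈0⇒x≈0 (0≤w zero) (sum-nonNegative (0≤w ∘ suc)) ∑≈0
  sum≈0⇒≈0 0≤w ∑≈0 (suc i) = sum≈0⇒≈0 (0≤w ∘ suc)
    (x+y≈0⇒y≈0 (0≤w zero) (sum-nonNegative (0≤w ∘ suc)) ∑≈0) i

  sum-zero : ∀ {n} {w : Fin n → Carrier} → (∀ i → w i ≈ 0#) → sum w ≈ 0#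
  sum-zero {n} w≈0 = trans (sum-cong-≋ w≈0) (sum-replicate-zero n)

  minimum : ∀ {a} {A : Set a} (k : A → Carrier) {a xs} → a ∈ xs →
            ∃[ m ] m ∈ xs × (∀ {b} → b ∈ xs → k m ≤ k b)
  minimum k {a} {xs} a∈ = argmin k a xs , argmin-all k a∈ (All.tabulate id) ,
    All.lookup (f[argmin]≤f[xs] a xs)
    where open Extrema totalOrder

-- Linear equations, independence and bases

module LinearAlgebra {c ℓ₁ ℓ₂} (ℝ : RealField c ℓ₁ ℓ₂) where

  open RealField ℝ hiding (zero)
  open OrderedField ℝ
  open Solver using (solve; _:=_; _:+_; _:*_; _:-_; :-_; con)
  open Polytopes ℝ using (Point; _·_; combination; 0ᵛ)
  open SemiringSum semiring using (sum; sum-cong-≋; *-distribˡ-sum; ∑-comm; sum-remove)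
  open import Relation.Binary.Reasoning.Setoid (RealField.setoid ℝ)

  linear : ∀ {n} → Carrier → Point n → Carrier → Point n → Point n
  linear a y b z i = a * y i + b * z i

  linear-· : ∀ {n} a (y : Point n) b (z x : Point n) →
             linear a y b z · x ≈ a * (y · x) + b * (z · x)
  linear-· {zero}  a y b z x = solve 2 (λ a b → con (ℤ.+ 0) := a :* con (ℤ.+ 0) :+ b :* con (ℤ.+ 0)) refl a b
  linear-· {suc n} a y b z x = trans
    (+-congˡ (linear-· a (tail y) b (tail z) (tail x)))
    (solve 7 (λ a y b z x p q → (a :* y :+ b :* z) :* x :+ (a :* p :+ b :* q) :=
                                a :* (y :* x :+ p) :+ b :* (z :* x :+ q))
      refl a (y zero) b (z zero) (x zero) (tail y · tail x) (tail z · tail x))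

  ·-combination : ∀ {n m} (h : Point n) w (p : Vector (Point n) m) →
                  h · combination w p ≈ sum (λ i → w i * (h · p i))
  ·-combination h w p = begin
    sum (λ j → h j * sum (λ i → w i * p i j))    ≈⟨ sum-cong-≋ (λ j → *-distribˡ-sum (h j) (λ i → w i * p i j)) ⟩
    sum (λ j → sum (λ i → h j * (w i * p i j)))  ≈⟨ ∑-comm (λ j i → h j * (w i * p i j)) ⟩
    sum (λ i → sum (λ j → h j * (w i * p i j)))  ≈⟨ sum-cong-≋ (λ i → sum-cong-≋ (λ j →
                                                     solve 3 (λ h w p → h :* (w :* p) := w :* (h :* p)) refl (h j) (w i) (p i j))) ⟩
    sum (λ i → sum (λ j → w i * (h j * p i j)))  ≈⟨ sum-cong-≋ (λ i → *-distribˡ-sum (w i) (λ j → h j * p i j)) ⟨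
    sum (λ i → w i * (h · p i))                  ∎

  ·-zeroʳ : ∀ {n} (y : Point n) {x : Point n} → (∀ i → x i ≈ 0#) → y · x ≈ 0#
  ·-zeroʳ y x≈0 = sum-zero (λ i → trans (*-congˡ (x≈0 i)) (zeroʳ (y i)))

  -- Gaussian elimination: every row other than the pivot row is combined with it so that the first
  -- unknown cancels. If the first column is zero, the first unit vector is a solution.
  kernel : ∀ {N m} → N ℕ.< m → (M : Fin N → Point m) →
           ∃[ w ] (∃[ i ] ¬ w i ≈ 0#) × (∀ j → M j · w ≈ 0#)
  kernel {N} {suc m} N<m M with any? (λ j → ¬? (M j zero ≟ 0#))
  ... | no all≈0 = (1# ∷ᵛ 0ᵛ) , (zero , 1≉0) , λ j → begin
    M j zero * 1# + tail (M j) · 0ᵛ   ≈⟨ +-cong (*-identityʳ _) (·-zeroʳ (tail (M j)) (λ _ → refl)) ⟩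
    M j zero + 0#                     ≈⟨ +-identityʳ _ ⟩
    M j zero                          ≈⟨ decidable-stable (M j zero ≟ 0#) (λ ≉0 → all≈0 (j , ≉0)) ⟩
    0#                                ∎
  kernel {suc N} {suc m} (ℕ.s≤s N<m) M | yes (j , p≉0)
    with w , (i , wi≉0) , Mw≈0 ← kernel N<m (λ k → linear (M j zero) (tail (M (punchIn j k)))
                                                            (- M (punchIn j k) zero) (tail (M j)))
    = v , (suc i , *-nonZero p≉0 wi≉0) , Mv≈0
    where
    p = M j zero
    t = tail (M j)

    -- The pivot row fixes the first coordinate once the others are chosen. Scaling these by p
    -- replaces a division and keeps `v` nonzero.
    v : Point (suc m)
    v = - (t · w) ∷ᵛ λ l → p * w l

    scale : ∀ {n} (r w : Point n) → r · (λ l → p * w l) ≈ p * (r · w)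
    scale r w = trans
      (sum-cong-≋ (λ l → solve 3 (λ r p w → r :* (p :* w) := p :* (r :* w)) refl (r l) p (w l)))
      (sym (*-distribˡ-sum p (λ l → r l * w l)))

    ·v : ∀ r → r · v ≈ linear p (tail r) (- r zero) t · w
    ·v r = begin
      r zero * - (t · w) + tail r · (λ l → p * w l)   ≈⟨ +-congˡ (scale (tail r) w) ⟩
      r zero * - (t · w) + p * (tail r · w)           ≈⟨ solve 4 (λ r t p q → r :* (:- t) :+ p :* q := p :* q :+ (:- r) :* t)
                                                           refl (r zero) (t · w) p (tail r · w) ⟩
      p * (tail r · w) + - r zero * (t · w)           ≈⟨ linear-· p (tail r) (- r zero) t w ⟨
      linear p (tail r) (- r zero) t · w              ∎

    Mv≈0 : ∀ k → M k · v ≈ 0#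
    Mv≈0 k with j ≟ᶠ k
    ... | yes ≡.refl = trans (·v (M j)) (trans (linear-· p t (- p) t w)
          (solve 2 (λ p q → p :* q :+ (:- p) :* q := con (ℤ.+ 0)) refl p (t · w)))
    ... | no j≢k = trans (·v (M k)) (≡.subst
          (λ k → linear p (tail (M k)) (- M k zero) t · w ≈ 0#)
          (punchIn-punchOut j≢k) (Mw≈0 (punchOut j≢k)))

  Independent : ∀ {n m} → Vector (Point n) m → Set _
  Independent B = ∀ w → (∀ j → combination w B j ≈ 0#) → ∀ i → w i ≈ 0#

  dependent : ∀ {n m} → n ℕ.< m → (B : Vector (Point n) m) →
              ∃[ w ] (∃[ i ] ¬ w i ≈ 0#) × (∀ j → combination w B j ≈ 0#)
  dependent n<m B with w , w≉0 , Bw≈0 ← kernel n<m (λ j i → B i j) =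
    w , w≉0 , λ j → trans (sum-cong-≋ (λ i → *-comm (w i) (B i j))) (Bw≈0 j)

  independent⇒≤ : ∀ {n m} {B : Vector (Point n) m} → Independent B → m ℕ.≤ n
  independent⇒≤ {n} {m} {B} ind = ℕ.≮⇒≥ λ n<m →
    let w , (i , wi≉0) , Bw≈0 = dependent n<m B in wi≉0 (ind w Bw≈0 i)

  -- With coordinate j deleted the vectors become dependent. If `y j` is nonzero, orthogonality to y
  -- makes their relation hold in coordinate j as well, against independence.
  annihilator-trivial : ∀ {n} {B : Vector (Point n) n} → Independent B →
                        ∀ y → (∀ i → y · B i ≈ 0#) → ∀ j → y j ≈ 0#
  annihilator-trivial {suc n} {B} ind y yB≈0 j = decidable-stable (y j ≟ 0#) contradictory
    where
    contradictory : ¬ ¬ y j ≈ 0#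
    contradictory yj≉0
      with w , (i , wi≉0) , wB≈0 ← dependent ℕ.≤-refl (λ i k → B i (punchIn j k))
      = wi≉0 (ind w v≈0 i)
      where
      v = combination w B

      v≈0 : ∀ k → v k ≈ 0#
      v≈0 k with j ≟ᶠ k
      ... | no j≢k = ≡.subst (λ k → v k ≈ 0#) (punchIn-punchOut j≢k) (wB≈0 (punchOut j≢k))
      ... | yes ≡.refl = xy≈0⇒y≈0 yj≉0 (begin
        y j * v j                                             ≈⟨ +-identityʳ _ ⟨
        y j * v j + 0#                                        ≈⟨ +-congˡ (·-zeroʳ (y ∘ punchIn j) wB≈0) ⟨
        y j * v j + (y ∘ punchIn j) · (v ∘ punchIn j)         ≈⟨ sum-remove {i = j} (λ k → y k * v k) ⟨
        y · v                                                 ≈⟨ ·-combination y w B ⟩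
        sum (λ i → w i * (y · B i))                           ≈⟨ sum-zero (λ i → trans (*-congˡ (yB≈0 i)) (zeroʳ (w i))) ⟩
        0#                                                    ∎)

  -- One vector more than the dimension gives a relation, and independence of `B` forces the
  -- coefficient of z in it to be nonzero; the relation is then solved for z.
  independent⇒spanning : ∀ {n} {B : Vector (Point n) n} → Independent B →
                         ∀ z → ∃[ w ] (∀ j → combination w B j ≈ z j)
  independent⇒spanning {n} {B} ind z
    with w , (i , wi≉0) , wzB≈0 ← dependent ℕ.≤-refl (z ∷ᵛ B) =
    v , λ j → *-cancelˡ (-‿nonZero w₀≉0) (begin
      - w₀ * combination v B j              ≈⟨ *-distribˡ-sum (- w₀) (λ i → v i * B i j) ⟩
      sum (λ i → - w₀ * (v i * B i j))      ≈⟨ sum-cong-≋ (λ i → cancel (w (suc i)) (B i j)) ⟩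
      sum (λ i → w (suc i) * B i j)         ≈⟨ isolate w₀ (z j) _ (wzB≈0 j) ⟩
      - w₀ * z j                            ∎)
    where
    w₀ = w zero

    w₀≉0 : ¬ w₀ ≈ 0#
    w₀≉0 w₀≈0 = wi≉0 (all≈0 i)
      where
      all≈0 : ∀ i → w i ≈ 0#
      all≈0 zero    = w₀≈0
      all≈0 (suc i) = ind (tail w) (λ j → trans
        (trans (sym (+-identityˡ _)) (+-congʳ (sym (trans (*-congʳ w₀≈0) (zeroˡ (z j))))))
        (wzB≈0 j)) i

    v : Fin n → Carrier
    v i = - (inv w₀ * w (suc i))

    cancel : ∀ a b → - w₀ * (- (inv w₀ * a) * b) ≈ a * b
    cancel a b = trans
      (solve 4 (λ w i a b → (:- w) :* ((:- (i :* a)) :* b) := (w :* i) :* (a :* b)) refl w₀ (inv w₀) a b)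
      (trans (*-congʳ (*-inverseʳ w₀≉0)) (*-identityˡ _))

    isolate : ∀ a x b → a * x + b ≈ 0# → b ≈ - a * x
    isolate a x b ax+b≈0 = begin
      b                         ≈⟨ solve 3 (λ a x b → b := (a :* x :+ b) :+ (:- a) :* x) refl a x b ⟩
      (a * x + b) + - a * x     ≈⟨ +-congʳ ax+b≈0 ⟩
      0# + - a * x              ≈⟨ +-identityˡ _ ⟩
      - a * x                   ∎

-- Finite lists, Boolean functions and numerical inequalities

private
  variable
    α ℓ : Level
    A : Set α

module _ {p q} {P : Pred A p} {Q : Pred A q} (P? : Decidable P) (Q? : Decidable Q) where

  length-filter-mono-≤ : ∀ xs → (∀ {x} → x ∈ xs → P x → Q x) →
                         length (filter P? xs) ℕ.≤ length (filter Q? xs)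
  length-filter-mono-≤ []       P⇒Q = ℕ.z≤n
  length-filter-mono-≤ (x ∷ xs) P⇒Q
    with ih ← length-filter-mono-≤ xs (P⇒Q ∘ there) | P? x | Q? x
  ... | yes _ | yes _ = ℕ.s≤s ih
  ... | yes p | no ¬q = contradiction (P⇒Q (here ≡.refl) p) ¬q
  ... | no _  | yes _ = ℕ.m≤n⇒m≤1+n ih
  ... | no _  | no _  = ih

  length-filter-mono-< : ∀ {x} xs → x ∈ xs → ¬ P x → Q x → (∀ {x} → x ∈ xs → P x → Q x) →
                         length (filter P? xs) ℕ.< length (filter Q? xs)
  length-filter-mono-< (x ∷ xs) (here ≡.refl) ¬p q P⇒Q
    with ih ← length-filter-mono-≤ xs (P⇒Q ∘ there) | P? x | Q? x
  ... | yes p | _     = contradiction p ¬p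
  ... | no _  | yes _ = ℕ.s≤s ih
  ... | no _  | no ¬q = contradiction q ¬q
  length-filter-mono-< (x ∷ xs) (there x∈) ¬p q P⇒Q
    with ih ← length-filter-mono-< xs x∈ ¬p q (P⇒Q ∘ there) | P? x | Q? x
  ... | yes _ | yes _ = ℕ.s≤s ih
  ... | yes p | no ¬q = contradiction (P⇒Q (here ≡.refl) p) ¬q
  ... | no _  | yes _ = ℕ.m≤n⇒m≤1+n ih
  ... | no _  | no _  = ih

-- Either k is already maximal or some larger number satisfies `Q`; for an undecidable `Q` this
-- alternative is available only under double negation. The fuel bounds the distance left to
-- `bound`.
¬¬-maximum : ∀ (Q : ℕ → Set ℓ) bound → (∀ k → Q k → k ℕ.≤ bound) → ∀ k → Q k →
          ¬ ¬ (∃[ m ] Q m × (∀ j → Q j → j ℕ.≤ m))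
¬¬-maximum Q bound Q≤ k q = go bound k q (ℕ.m≤n+m bound k)
  where
  go : ∀ fuel k → Q k → bound ℕ.≤ k ℕ.+ fuel → ¬ ¬ (∃[ m ] Q m × (∀ j → Q j → j ℕ.≤ m))
  go zero       k q b≤ none = none (k , q , λ j qj →
    ℕ.≤-trans (Q≤ j qj) (ℕ.≤-trans b≤ (ℕ.≤-reflexive (ℕ.+-identityʳ k))))
  go (suc fuel) k q b≤ none = none (k , q , λ j qj → ℕ.≮⇒≥ λ k<j →
    go fuel j qj (ℕ.≤-trans b≤ (ℕ.≤-trans (ℕ.≤-reflexive (ℕ.+-suc k fuel)) (ℕ.+-monoˡ-≤ fuel k<j))) none)

part : (A → Bool) → Bool → List A → List A
part f b = filter (λ x → f x Bool.≟ b)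

∈-part⁺ : ∀ (f : A → Bool) {b x xs} → x ∈ xs → f x ≡ b → x ∈ part f b xs
∈-part⁺ f {b} = ∈-filter⁺ (λ x → f x Bool.≟ b)

∈-part⁻ : ∀ (f : A → Bool) {b x} xs → x ∈ part f b xs → x ∈ xs × f x ≡ b
∈-part⁻ f {b} xs = ∈-filter⁻ (λ x → f x Bool.≟ b) {xs = xs}

length-part : ∀ (f : A → Bool) b xs →
              length xs ≡ length (part f b xs) ℕ.+ length (part f (not b) xs)
length-part f b []       = ≡.refl
length-part f b (x ∷ xs) with ih ← length-part f b xs | f x | b
... | true  | true  = ≡.cong suc ih
... | true  | false = ≡.trans (≡.cong suc ih) (≡.sym (ℕ.+-suc _ _))
... | false | true  = ≡.trans (≡.cong suc ih) (≡.sym (ℕ.+-suc _ _))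
... | false | false = ≡.cong suc ih

length-part-< : ∀ (f : A → Bool) {b x} xs → x ∈ xs → f x ≢ b →
                length (part f b xs) ℕ.< length xs
length-part-< f {b} xs x∈ fx≢b = filter-notAll (λ x → f x Bool.≟ b) xs (lose x∈ fx≢b)

-- Functions are compared by their restrictions to S, so that the same list of functions can be
-- counted again on a smaller list of points.
Agree : List A → Rel (A → Bool) _
Agree S c d = ∀ {s} → s ∈ S → c s ≡ d s

Differ : List A → Rel (A → Bool) _
Differ S c d = ¬ Agree S c d

agree? : ∀ (S : List A) c d → Dec (Agree S c d)
agree? S c d with All.all? (λ s → c s Bool.≟ d s) S
... | yes all = yes (All.lookup all)
... | no ¬all = no λ agree → ¬all (All.tabulate agree)

differ-at : ∀ (S : List A) {c d} → Differ S c d → ∃[ s ] s ∈ S × c s ≢ d s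
differ-at S {c} {d} differ with Any.any? (λ s → ¬? (c s Bool.≟ d s)) S
... | yes any = find any
... | no none = contradiction
  (λ {s} s∈ → decidable-stable (c s Bool.≟ d s) λ ≢ → none (lose s∈ ≢)) differ

AllPairs-map-∈ : ∀ {R R′ : Rel A ℓ} {xs} → (∀ {x y} → x ∈ xs → y ∈ xs → R x y → R′ x y) →
                 AllPairs R xs → AllPairs R′ xs
AllPairs-map-∈ f []          = []
AllPairs-map-∈ f (rs ∷ prs) =
  All.tabulate (λ y∈ → f (here ≡.refl) (there y∈) (All.lookup rs y∈)) ∷
  AllPairs-map-∈ (λ x∈ y∈ → f (there x∈) (there y∈)) prs

doesTrue⇒ : ∀ {P : Set ℓ} (P? : Dec P) → does P? ≡ true → P
doesTrue⇒ (yes p) _ = p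

doesFalse⇒ : ∀ {P : Set ℓ} (P? : Dec P) → does P? ≡ false → ¬ P
doesFalse⇒ (no ¬p) _ = ¬p

AllPairs-absurd⇒length≤1 : ∀ {R : Rel A ℓ} {xs} → (∀ {x y} → x ∈ xs → y ∈ xs → ¬ R x y) →
                           AllPairs R xs → length xs ℕ.≤ 1
AllPairs-absurd⇒length≤1 ¬R []                    = ℕ.z≤n
AllPairs-absurd⇒length≤1 ¬R (_ ∷ [])              = ℕ.s≤s ℕ.z≤n
AllPairs-absurd⇒length≤1 ¬R ((r ∷ _) ∷ (_ ∷ _)) = contradiction r (¬R (here ≡.refl) (there (here ≡.refl)))

larger-part : ∀ (f : A → Bool) xs →
              ∃[ b ] length (part f (not b) xs) ℕ.≤ length (part f b xs)
larger-part f xs with ℕ.≤-total (length (part f true xs)) (length (part f false xs))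
... | inj₁ t≤f = false , t≤f
... | inj₂ f≤t = true , f≤t

-- (a₀ + a₁)(l + δ) ≤ 2(a₀ l + a₁ δ) is the rearrangement inequality.
rearrangement : ∀ {a₀ a₁ l δ} r p → a₁ ℕ.≤ a₀ → δ ℕ.≤ l →
                a₀ ℕ.* l ℕ.≤ r ℕ.* p → a₁ ℕ.* δ ℕ.* 2 ℕ.≤ 2 ℕ.* p →
                (a₀ ℕ.+ a₁) ℕ.* (l ℕ.+ δ) ℕ.≤ suc r ℕ.* (2 ℕ.* p)
rearrangement {a₀} {a₁} {l} {δ} r p a₁≤a₀ δ≤l a₀l≤ a₁δ≤
  with u , ≡.refl ← ℕ.m≤n⇒∃[o]m+o≡n a₁≤a₀ | v , ≡.refl ← ℕ.m≤n⇒∃[o]m+o≡n δ≤l = begin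
  (a₁ ℕ.+ u ℕ.+ a₁) ℕ.* (δ ℕ.+ v ℕ.+ δ)                   ≤⟨ ℕ.m≤m+n _ (u ℕ.* v) ⟩
  (a₁ ℕ.+ u ℕ.+ a₁) ℕ.* (δ ℕ.+ v ℕ.+ δ) ℕ.+ u ℕ.* v       ≡⟨ solve 4 (λ a u d v →
    (a :+ u :+ a) :* (d :+ v :+ d) :+ u :* v := con 2 :* ((a :+ u) :* (d :+ v)) :+ a :* d :* con 2)
    ≡.refl a₁ u δ v ⟩
  2 ℕ.* ((a₁ ℕ.+ u) ℕ.* (δ ℕ.+ v)) ℕ.+ a₁ ℕ.* δ ℕ.* 2     ≤⟨ ℕ.+-mono-≤ (ℕ.*-monoʳ-≤ 2 a₀l≤) a₁δ≤ ⟩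
  2 ℕ.* (r ℕ.* p) ℕ.+ 2 ℕ.* p                             ≡⟨ solve 2 (λ r p →
    con 2 :* (r :* p) :+ con 2 :* p := (con 1 :+ r) :* (con 2 :* p)) ≡.refl r p ⟩
  suc r ℕ.* (2 ℕ.* p)                                     ∎
  where
  open ℕ.≤-Reasoning
  open +-*-Solver

halving : ∀ {m n o p q} → m ≡ n ℕ.+ o → n ℕ.* (2 ℕ.* p) ℕ.≤ q → o ℕ.* (2 ℕ.* p) ℕ.≤ q → m ℕ.* p ℕ.≤ q
halving {n = n} {o} {p} {q} ≡.refl n≤ o≤ = ℕ.*-cancelʳ-≤ ((n ℕ.+ o) ℕ.* p) q 2 (begin
  (n ℕ.+ o) ℕ.* p ℕ.* 2                     ≡⟨ solve 3 (λ n o p →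
    (n :+ o) :* p :* con 2 := n :* (con 2 :* p) :+ o :* (con 2 :* p)) ≡.refl n o p ⟩
  n ℕ.* (2 ℕ.* p) ℕ.+ o ℕ.* (2 ℕ.* p)       ≤⟨ ℕ.+-mono-≤ n≤ o≤ ⟩
  q ℕ.+ q                                   ≡⟨ solve 1 (λ q → q :+ q := q :* con 2) ≡.refl q ⟩
  q ℕ.* 2                                   ∎)
  where
  open ℕ.≤-Reasoning
  open +-*-Solver

*-bound : ∀ m n {p q} → m ℕ.* 2 ℕ.≤ p → n ℕ.* p ℕ.≤ q → m ℕ.* n ℕ.* 2 ℕ.≤ q
*-bound m n {p} {q} 2m≤p np≤q = begin
  m ℕ.* n ℕ.* 2       ≡⟨ solve 2 (λ m n → m :* n :* con 2 := n :* (m :* con 2)) ≡.refl m n ⟩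
  n ℕ.* (m ℕ.* 2)     ≤⟨ ℕ.*-monoʳ-≤ n 2m≤p ⟩
  n ℕ.* p             ≤⟨ np≤q ⟩
  q                   ∎
  where
  open ℕ.≤-Reasoning
  open +-*-Solver

doubled-bound : ∀ d {m n l} → n ℕ.≤ 2 ℕ.* m → m ℕ.* l ℕ.≤ d ℕ.* 2 ℕ.^ d → n ℕ.* l ℕ.≤ d ℕ.* 2 ℕ.^ (d ℕ.+ 1)
doubled-bound d {m} {n} {l} n≤2m ml≤ = begin
  n ℕ.* l                         ≤⟨ ℕ.*-monoˡ-≤ l n≤2m ⟩
  2 ℕ.* m ℕ.* l                   ≡⟨ ℕ.*-assoc 2 m l ⟩
  2 ℕ.* (m ℕ.* l)                 ≤⟨ ℕ.*-monoʳ-≤ 2 ml≤ ⟩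
  2 ℕ.* (d ℕ.* 2 ℕ.^ d)           ≡⟨ solve 2 (λ d p → con 2 :* (d :* p) := d :* (con 2 :* p)) ≡.refl d (2 ℕ.^ d) ⟩
  d ℕ.* 2 ℕ.^ suc d               ≡⟨ ≡.cong (λ k → d ℕ.* 2 ℕ.^ k) (ℕ.+-comm 1 d) ⟩
  d ℕ.* 2 ℕ.^ (d ℕ.+ 1)           ∎
  where
  open ℕ.≤-Reasoning
  open +-*-Solver

-- Here k counts the facet functionals together with their complements. Halving leaves (d + 1) 2ᵈ,
-- and d + 1 ≤ 2 d.
halved-bound : ∀ d {n l k} → 1 ℕ.≤ d → k ≡ l ℕ.+ l → n ℕ.* k ℕ.≤ suc d ℕ.* 2 ℕ.^ suc d →
               n ℕ.* l ℕ.≤ d ℕ.* 2 ℕ.^ (d ℕ.+ 1)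
halved-bound d {n} {l} 1≤d ≡.refl nk≤ = ℕ.*-cancelʳ-≤ (n ℕ.* l) (d ℕ.* 2 ℕ.^ (d ℕ.+ 1)) 2 (begin
  n ℕ.* l ℕ.* 2                   ≡⟨ solve 2 (λ n l → n :* l :* con 2 := n :* (l :+ l)) ≡.refl n l ⟩
  n ℕ.* (l ℕ.+ l)                 ≤⟨ nk≤ ⟩
  suc d ℕ.* 2 ℕ.^ suc d           ≤⟨ ℕ.*-monoˡ-≤ (2 ℕ.^ suc d) (ℕ.+-monoˡ-≤ d 1≤d) ⟩
  (d ℕ.+ d) ℕ.* 2 ℕ.^ suc d       ≡⟨ solve 2 (λ d p → (d :+ d) :* p := d :* p :* con 2) ≡.refl d (2 ℕ.^ suc d) ⟩
  d ℕ.* 2 ℕ.^ suc d ℕ.* 2         ≡⟨ ≡.cong (λ k → d ℕ.* 2 ℕ.^ k ℕ.* 2) (ℕ.+-comm 1 d) ⟩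
  d ℕ.* 2 ℕ.^ (d ℕ.+ 1) ℕ.* 2     ∎)
  where
  open ℕ.≤-Reasoning
  open +-*-Solver

-- Facets, rank and two-levelness in terms of functionals

module Functionals {c ℓ₁ ℓ₂} (ℝ : RealField c ℓ₁ ℓ₂) {N : ℕ} {X : Set}
  (x : X → Polytopes.Point ℝ N) (one : Polytopes.Point ℝ N)
  (one≈1 : ∀ s → RealField._≈_ ℝ (Polytopes._·_ ℝ one (x s)) (RealField.1# ℝ)) where

  open RealField ℝ hiding (zero)
  open Polytopes ℝ
  open OrderedField ℝ
  open LinearAlgebra ℝ
  open Solver using (solve; _:=_; _:+_; _:*_; _:-_; :-_; con)
  open SemiringSum semiring using (sum)
  open import Relation.Binary.Reasoning.Setoid (RealField.setoid ℝ)

  infixl 8 _at_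
  _at_ : Point N → X → Carrier
  y at s = y · x s

  indicator : Bool → Carrier
  indicator true  = 1#
  indicator false = 0#

  0≤indicator : ∀ b → 0# ≤ indicator b
  0≤indicator true  = 0≤1
  0≤indicator false = ≤-refl

  -- The equation is required at every index and not just on some list S. This makes `Binary`, and
  -- later `Separated`, independent of S, so that both pass to a facet unchanged.
  record Realises (y : Point N) (χ : X → Bool) : Set ℓ₁ where
    constructor realises
    field
      value : ∀ s → y at s ≈ indicator (χ s)

  open Realises

  Binary : (X → Bool) → Set (c ⊔ ℓ₁)
  Binary χ = ∃[ y ] Realises y χ

  -- The field `multiples` replaces the dimension of a facet: it says that the zeros of y span a
  -- hyperplane in the span of S.
  record Facet (S : List X) (y : Point N) : Set (c ⊔ ℓ₁ ⊔ ℓ₂) where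
    field
      nonNegative : ∀ {s} → s ∈ S → 0# ≤ y at s
      nonZero     : ∃[ s ] s ∈ S × ¬ y at s ≈ 0#
      multiples   : ∀ z → (∀ {s} → s ∈ S → y at s ≈ 0# → z at s ≈ 0#) →
                    ∃[ μ ] (∀ {s} → s ∈ S → z at s ≈ μ * y at s)

  -- Only the zero set of the 0/1 functional is prescribed; `facet-realised` shows that this
  -- functional is then itself a facet.
  TwoLevelOn : List X → Set (c ⊔ ℓ₁ ⊔ ℓ₂)
  TwoLevelOn S = ∀ y → Facet S y →
    ∃[ χ ] Binary χ × (∀ {s} → s ∈ S → (χ s ≡ false → y at s ≈ 0#) × (y at s ≈ 0# → χ s ≡ false))

  -- A certificate of linear independence: each point carries a functional that is nonzero there and
  -- vanishes at all later points. A new point is added in front by exhibiting one functional,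
  -- without solving equations.
  Triangular : ∀ {k} → Vector X k → Set (c ⊔ ℓ₁)
  Triangular {zero}  xs = ⊤
  Triangular {suc k} xs =
    (∃[ y ] ¬ y at head xs ≈ 0# × (∀ i → y at tail xs i ≈ 0#)) × Triangular (tail xs)

  RankAtMost : List X → ℕ → Set (c ⊔ ℓ₁)
  RankAtMost S r = ∀ {k} (xs : Vector X k) → Triangular xs → (∀ i → xs i ∈ S) → k ℕ.≤ r

  triangular⇒independent : ∀ {k} (xs : Vector X k) → Triangular xs → Independent (x ∘ xs)
  triangular⇒independent {suc k} xs ((y , y₀≉0 , y≈0) , tri) w wx≈0 = w≈0
    where
    w₀≈0 : w zero ≈ 0#
    w₀≈0 = xy≈0⇒y≈0 y₀≉0 (begin
      y at head xs * w zero                                          ≈⟨ *-comm _ _ ⟩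
      w zero * y at head xs                                          ≈⟨ +-identityʳ _ ⟨
      w zero * y at head xs + 0#
        ≈⟨ +-congˡ (sum-zero (λ i → trans (*-congˡ (y≈0 i)) (zeroʳ (w (suc i))))) ⟨
      sum (λ i → w i * y at xs i)                                    ≈⟨ ·-combination y w (x ∘ xs) ⟨
      y · combination w (x ∘ xs)                                     ≈⟨ ·-zeroʳ y wx≈0 ⟩
      0#                                                             ∎)

    w≈0 : ∀ i → w i ≈ 0#
    w≈0 zero    = w₀≈0
    w≈0 (suc i) = triangular⇒independent (tail xs) tri (tail w) (λ j → begin
      combination (tail w) (x ∘ tail xs) j                    ≈⟨ +-identityˡ _ ⟨
      0# + combination (tail w) (x ∘ tail xs) j
        ≈⟨ +-congʳ (trans (*-congʳ w₀≈0) (zeroˡ (x (head xs) j))) ⟨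
      combination w (x ∘ xs) j                                ≈⟨ wx≈0 j ⟩
      0#                                                      ∎) i

  rankAtMost-dimension : ∀ S → RankAtMost S N
  rankAtMost-dimension S xs tri _ = independent⇒≤ (triangular⇒independent xs tri)

  linear-at : ∀ a y b z s → linear a y b z at s ≈ a * y at s + b * z at s
  linear-at a y b z s = linear-· a y b z (x s)

  module _ {f χ} (f≈χ : Realises f χ) where

    false⇒≈0 : ∀ {s} → χ s ≡ false → f at s ≈ 0#
    false⇒≈0 {s} eq = trans (value f≈χ s) (reflexive (≡.cong indicator eq))

    true⇒≈1 : ∀ {s} → χ s ≡ true → f at s ≈ 1#
    true⇒≈1 {s} eq = trans (value f≈χ s) (reflexive (≡.cong indicator eq))

    ≈0⇒false : ∀ {s} → f at s ≈ 0# → χ s ≡ false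
    ≈0⇒false {s} fs≈0 with χ s | value f≈χ s
    ... | false | _    = ≡.refl
    ... | true  | fs≈1 = contradiction (trans (sym fs≈1) fs≈0) 1≉0

    ≉0⇒true : ∀ {s} → ¬ f at s ≈ 0# → χ s ≡ true
    ≉0⇒true {s} fs≉0 with χ s in eq
    ... | false = contradiction (false⇒≈0 eq) fs≉0
    ... | true  = ≡.refl

    realises-nonNegative : ∀ s → 0# ≤ f at s
    realises-nonNegative s = ≤-respʳ-≈ (sym (value f≈χ s)) (0≤indicator (χ s))

    realises-not : Realises (linear 1# one (- 1#) f) (not ∘ χ)
    realises-not = realises λ s → trans (linear-at 1# one (- 1#) f s) (trans
      (+-cong (*-congˡ (one≈1 s)) (*-congˡ (value f≈χ s))) (complement (χ s)))
      where
      complement : ∀ b → 1# * 1# + - 1# * indicator b ≈ indicator (not b)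
      complement true  = solve 0 (con (ℤ.+ 1) :* con (ℤ.+ 1) :+ (:- con (ℤ.+ 1)) :* con (ℤ.+ 1) := con (ℤ.+ 0)) refl
      complement false = solve 0 (con (ℤ.+ 1) :* con (ℤ.+ 1) :+ (:- con (ℤ.+ 1)) :* con (ℤ.+ 0) := con (ℤ.+ 1)) refl

  binary-not : ∀ {χ} → Binary χ → Binary (not ∘ χ)
  binary-not (f , f≈χ) = _ , realises-not f≈χ

  -- Any system inside the zero set of f can be prolonged by a point off the facet, with f itself as
  -- the witness.
  rankAtMost-facet : ∀ {S f χ r} → Realises f χ → Facet S f → RankAtMost S (suc r) →
                     RankAtMost (part χ false S) r
  rankAtMost-facet {S} {f} {χ} f≈χ facet rank xs tri xs∈ = ℕ.s≤s⁻¹ (rank (s₁ ∷ᵛ xs)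
    ((f , fs₁≉0 , λ i → false⇒≈0 f≈χ (proj₂ (∈-part⁻ χ S (xs∈ i)))) , tri)
    λ { zero → s₁∈ ; (suc i) → proj₁ (∈-part⁻ χ S (xs∈ i)) })
    where
    open Facet facet
    s₁    = proj₁ nonZero
    s₁∈   = proj₁ (proj₂ nonZero)
    fs₁≉0 = proj₂ (proj₂ nonZero)

  -- Subtracting the least value of y outside the facet f makes y nonnegative on S with
  -- a further zero s*, which is what prevents its multiples from involving f.
  twoLevelOn-facet : ∀ {S f χ} → Realises f χ → Facet S f → TwoLevelOn S →
                     TwoLevelOn (part χ false S)
  twoLevelOn-facet {S} {f} {χ} f≈χ F twoLevel y Y
    with s₁ , s₁∈S , fs₁≉0 ← Facet.nonZero F
    with s* , s*∈ , least ← minimum (y at_) (∈-part⁺ χ s₁∈S (≉0⇒true f≈χ fs₁≉0))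
    with s*∈S , χs*≡true ← ∈-part⁻ χ S s*∈
    = χ′ , binary , λ s∈ →
      let s∈S , χs≡false = ∈-part⁻ χ S s∈ in
      (λ eq → trans (sym (y′≈y χs≡false)) (proj₁ (correct s∈S) eq)) ,
      (λ ys≈0 → proj₂ (correct s∈S) (trans (y′≈y χs≡false) ys≈0))
    where
    module Y = Facet Y
    y′ = linear 1# y (- (y at s*)) f

    y′-at : ∀ s → y′ at s ≈ y at s - y at s* * f at s
    y′-at s = trans (linear-at 1# y (- (y at s*)) f s)
      (solve 3 (λ a b c → con (ℤ.+ 1) :* a :+ (:- b) :* c := a :- b :* c) refl (y at s) (y at s*) (f at s))

    y′≈y : ∀ {s} → χ s ≡ false → y′ at s ≈ y at s
    y′≈y {s} eq = trans (y′-at s) (trans (+-congˡ (-‿cong (*-congˡ (false⇒≈0 f≈χ eq))))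
      (solve 2 (λ a b → a :- b :* con (ℤ.+ 0) := a) refl (y at s) (y at s*)))

    y′≈y-y* : ∀ {s} → χ s ≡ true → y′ at s ≈ y at s - y at s*
    y′≈y-y* {s} eq = trans (y′-at s)
      (+-congˡ (-‿cong (trans (*-congˡ (true⇒≈1 f≈χ eq)) (*-identityʳ _))))

    y′s*≈0 : y′ at s* ≈ 0#
    y′s*≈0 = trans (y′≈y-y* χs*≡true) (-‿inverseʳ _)

    Y′ : Facet S y′
    Y′ = record
      { nonNegative = λ {s} s∈ → nonNegative s∈ (χ s) ≡.refl
      ; nonZero = let s , s∈ , ys≉0 = Y.nonZero ; s∈S , eq = ∈-part⁻ χ S s∈ in
          s , s∈S , λ y′s≈0 → ys≉0 (trans (sym (y′≈y eq)) y′s≈0)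
      ; multiples = multiples
      }
      where
      nonNegative : ∀ {s} → s ∈ S → ∀ b → χ s ≡ b → 0# ≤ y′ at s
      nonNegative s∈ false eq = ≤-respʳ-≈ (sym (y′≈y eq)) (Y.nonNegative (∈-part⁺ χ s∈ eq))
      nonNegative s∈ true  eq = ≤-respʳ-≈ (sym (y′≈y-y* eq)) (x≤y⇒0≤y-x (least (∈-part⁺ χ s∈ eq)))

      multiples : ∀ z → (∀ {s} → s ∈ S → y′ at s ≈ 0# → z at s ≈ 0#) →
                  ∃[ μ ] (∀ {s} → s ∈ S → z at s ≈ μ * y′ at s)
      multiples z z≈0
        with μ , z≈μy ← Y.multiples z (λ s∈ ys≈0 → let s∈S , eq = ∈-part⁻ χ S s∈ in
                          z≈0 s∈S (trans (y′≈y eq) ys≈0))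
        -- The error z - μ y′ vanishes on the zeros of f, so it is ν f on S. At s* both z and y′
        -- vanish while f is 1, hence ν is 0.
        with ν , h≈νf ← Facet.multiples F (linear 1# z (- μ) y′) (λ {s} s∈ fs≈0 →
               let eq = ≈0⇒false f≈χ fs≈0 in
               trans (linear-at 1# z (- μ) y′ s)
                 (trans (+-cong (*-congˡ (z≈μy (∈-part⁺ χ s∈ eq))) (*-congˡ (y′≈y eq)))
                 (solve 2 (λ m y → con (ℤ.+ 1) :* (m :* y) :+ (:- m) :* y := con (ℤ.+ 0)) refl μ (y at s))))
        = μ , λ {s} s∈ → let h≈0 = trans (h≈νf s∈) (trans (*-congʳ ν≈0) (zeroˡ _)) in begin
            z at s                              ≈⟨ split z μ s ⟩
            linear 1# z (- μ) y′ at s + μ * y′ at s   ≈⟨ +-congʳ h≈0 ⟩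
            0# + μ * y′ at s                    ≈⟨ +-identityˡ _ ⟩
            μ * y′ at s                         ∎
        where
        split : ∀ z μ s → z at s ≈ linear 1# z (- μ) y′ at s + μ * y′ at s
        split z μ s = trans
          (solve 3 (λ z m y → z := (con (ℤ.+ 1) :* z :+ (:- m) :* y) :+ m :* y) refl (z at s) μ (y′ at s))
          (+-congʳ (sym (linear-at 1# z (- μ) y′ s)))

        ν≈0 : ν ≈ 0#
        ν≈0 = begin
          ν                                     ≈⟨ *-identityʳ ν ⟨
          ν * 1#                                ≈⟨ *-congˡ (true⇒≈1 f≈χ χs*≡true) ⟨
          ν * f at s*                           ≈⟨ h≈νf s*∈S ⟨
          linear 1# z (- μ) y′ at s*            ≈⟨ linear-at 1# z (- μ) y′ s* ⟩
          1# * z at s* + - μ * y′ at s*         ≈⟨ +-cong (*-congˡ (z≈0 s*∈S y′s*≈0)) (*-congˡ y′s*≈0) ⟩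
          1# * 0# + - μ * 0#                    ≈⟨ solve 1 (λ m → con (ℤ.+ 1) :* con (ℤ.+ 0) :+ (:- m) :* con (ℤ.+ 0) := con (ℤ.+ 0)) refl μ ⟩
          0#                                    ∎

    χ′      = proj₁ (twoLevel y′ Y′)
    binary  = proj₁ (proj₂ (twoLevel y′ Y′))
    correct = λ {s} → proj₂ (proj₂ (twoLevel y′ Y′)) {s}

  -- Facets as functionals with the most zeros

  zeros : List X → Point N → ℕ
  zeros S y = length (filter (λ s → y at s ≟ 0#) S)

  record Valid (S : List X) (y : Point N) : Set (c ⊔ ℓ₁ ⊔ ℓ₂) where
    constructor valid
    field
      nonNegative : ∀ {s} → s ∈ S → 0# ≤ y at s
      nonZero     : ∃[ s ] s ∈ S × ¬ y at s ≈ 0#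

  -- Rotating y towards h about their common zeros until a new zero s* appears: s* is
  -- where the ratio of h to y is least.
  rotate : ∀ {S y} → Valid S y → ∀ h → (∀ {s} → s ∈ S → y at s ≈ 0# → h at s ≈ 0#) →
           ∀ {s₁} → s₁ ∈ S → ¬ y at s₁ ≈ 0# → h at s₁ ≈ 0# →
           ∀ {s₂} → s₂ ∈ S → ¬ 0# ≤ h at s₂ →
           ∃[ y′ ] Valid S y′ × zeros S y ℕ.< zeros S y′
  rotate {S} {y} Y h h≈0 {s₁} s₁∈ ys₁≉0 hs₁≈0 {s₂} s₂∈ hs₂≱0
    with s* , s*∈₊ , least ← minimum (λ s → h at s * inv (y at s))
           (∈-filter⁺ (λ s → ¬? (y at s ≟ 0#)) s₂∈
             λ ys₂≈0 → hs₂≱0 (≤-reflexive (sym (h≈0 s₂∈ ys₂≈0))))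
    with s*∈ , ys*≉0 ← ∈-filter⁻ (λ s → ¬? (y at s ≟ 0#)) {xs = S} s*∈₊
    = y′ , valid y′-nonNegative (s₁ , s₁∈ , y′s₁≉0) ,
      length-filter-mono-< (λ s → y at s ≟ 0#) (λ s → y′ at s ≟ 0#) S s*∈ ys*≉0
        (trans (y′-at s*) (solve 2 (λ a b → a :* b :- b :* a := con (ℤ.+ 0)) refl (y at s*) (h at s*)))
        (λ s∈ ys≈0 → y′≈0 s∈ ys≈0)
    where
    open Valid Y

    ratio : X → Carrier
    ratio s = h at s * inv (y at s)

    h≈y*ratio : ∀ {s} → ¬ y at s ≈ 0# → h at s ≈ y at s * ratio s
    h≈y*ratio {s} ys≉0 = sym (trans
      (solve 3 (λ a b c → a :* (b :* c) := b :* (a :* c)) refl (y at s) (h at s) (inv (y at s)))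
      (trans (*-congˡ (*-inverseʳ ys≉0)) (*-identityʳ _)))

    ys₂≉0 : ¬ y at s₂ ≈ 0#
    ys₂≉0 ys₂≈0 = hs₂≱0 (≤-reflexive (sym (h≈0 s₂∈ ys₂≈0)))

    ratio₂≱0 : ¬ 0# ≤ ratio s₂
    ratio₂≱0 0≤r = hs₂≱0 (≤-respʳ-≈ (sym (h≈y*ratio ys₂≉0)) (*-nonNegative (nonNegative s₂∈) 0≤r))

    ratio*≱0 : ¬ 0# ≤ ratio s*
    ratio*≱0 0≤r = ratio₂≱0 (≤-trans 0≤r (least (∈-filter⁺ (λ s → ¬? (y at s ≟ 0#)) s₂∈ ys₂≉0)))

    ratio*≤0 : ratio s* ≤ 0#
    ratio*≤0 with ≤-total 0# (ratio s*)
    ... | inj₁ 0≤r = contradiction 0≤r ratio*≱0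
    ... | inj₂ r≤0 = r≤0

    -hs* : - (h at s*) ≈ y at s* * - ratio s*
    -hs* = trans (-‿cong (h≈y*ratio ys*≉0))
      (solve 2 (λ a b → :- (a :* b) := a :* :- b) refl (y at s*) (ratio s*))

    -hs*≉0 : ¬ - (h at s*) ≈ 0#
    -hs*≉0 ≈0 = *-nonZero ys*≉0 (-‿nonZero (λ r≈0 → ratio*≱0 (≤-reflexive (sym r≈0))))
      (trans (sym -hs*) ≈0)

    -- This is h - ratio s* · y multiplied by the positive number y at s*. Since the ratio is
    -- negative, it stays nonzero at s₁, where h vanishes.
    y′ = linear (y at s*) h (- (h at s*)) y

    y′-at : ∀ s → y′ at s ≈ y at s* * h at s - h at s* * y at s
    y′-at s = trans (linear-at (y at s*) h (- (h at s*)) y s)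
      (solve 4 (λ a b c d → a :* b :+ (:- c) :* d := a :* b :- c :* d) refl
        (y at s*) (h at s) (h at s*) (y at s))

    y′≈0 : ∀ {s} → s ∈ S → y at s ≈ 0# → y′ at s ≈ 0#
    y′≈0 {s} s∈ ys≈0 = trans (y′-at s)
      (trans (+-cong (*-congˡ (h≈0 s∈ ys≈0)) (-‿cong (*-congˡ ys≈0)))
      (solve 2 (λ a b → a :* con (ℤ.+ 0) :- b :* con (ℤ.+ 0) := con (ℤ.+ 0)) refl (y at s*) (h at s*)))

    y′s₁≉0 : ¬ y′ at s₁ ≈ 0#
    y′s₁≉0 ≈0 = *-nonZero -hs*≉0 ys₁≉0 (begin
      - (h at s*) * y at s₁                        ≈⟨ solve 3 (λ a b c → a :* b := c :* con (ℤ.+ 0) :+ a :* b) refl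
                                                        (- (h at s*)) (y at s₁) (y at s*) ⟩
      y at s* * 0# + - (h at s*) * y at s₁         ≈⟨ +-congʳ (*-congˡ hs₁≈0) ⟨
      y at s* * h at s₁ + - (h at s*) * y at s₁    ≈⟨ linear-at (y at s*) h (- (h at s*)) y s₁ ⟨
      y′ at s₁                                     ≈⟨ ≈0 ⟩
      0#                                           ∎)

    y′-nonNegative : ∀ {s} → s ∈ S → 0# ≤ y′ at s
    y′-nonNegative {s} s∈ with y at s ≟ 0#
    ... | yes ys≈0 = ≤-reflexive (sym (y′≈0 s∈ ys≈0))
    ... | no  ys≉0 = ≤-respʳ-≈ (begin
      y at s* * y at s * (ratio s - ratio s*)
        ≈⟨ solve 4 (λ a b r q → a :* b :* (r :- q) := a :* (b :* r) :- (a :* q) :* b) refl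
             (y at s*) (y at s) (ratio s) (ratio s*) ⟩
      y at s* * (y at s * ratio s) - y at s* * ratio s* * y at s
        ≈⟨ +-cong (*-congˡ (h≈y*ratio ys≉0)) (-‿cong (*-congʳ (h≈y*ratio ys*≉0))) ⟨
      y at s* * h at s - h at s* * y at s
        ≈⟨ y′-at s ⟨
      y′ at s ∎)
      (*-nonNegative (*-nonNegative (nonNegative s*∈) (nonNegative s∈))
        (x≤y⇒0≤y-x (least (∈-filter⁺ (λ s → ¬? (y at s ≟ 0#)) s∈ ys≉0))))

  -- The combination h of z and y chosen to vanish at s₁ also vanishes at the zeros of y. A negative
  -- value of h or of -h would let y be rotated so as to gain a zero; hence h is zero on S and z is
  -- a multiple of y.
  maximal-valid⇒facet : ∀ {S y} → Valid S y → (∀ {z} → Valid S z → zeros S z ℕ.≤ zeros S y) → Facet S y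
  maximal-valid⇒facet {S} {y} Y maximal = record
    { nonNegative = nonNegative ; nonZero = nonZero ; multiples = multiples }
    where
    open Valid Y
    s₁    = proj₁ nonZero
    s₁∈   = proj₁ (proj₂ nonZero)
    ys₁≉0 = proj₂ (proj₂ nonZero)

    multiples : ∀ z → (∀ {s} → s ∈ S → y at s ≈ 0# → z at s ≈ 0#) →
                ∃[ μ ] (∀ {s} → s ∈ S → z at s ≈ μ * y at s)
    multiples z z≈0 = inv (y at s₁) * z at s₁ , λ {s} s∈ → *-cancelˡ ys₁≉0 (begin
      y at s₁ * z at s                                    ≈⟨ solve 3 (λ a b c → a :* b := (a :* b :+ (:- c)) :+ c) refl _ _ (z at s₁ * y at s) ⟩
      (y at s₁ * z at s + - (z at s₁ * y at s)) + z at s₁ * y at s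
        ≈⟨ +-congʳ (trans (sym (h-at s)) (h≈0 s∈)) ⟩
      0# + z at s₁ * y at s                               ≈⟨ +-identityˡ _ ⟩
      z at s₁ * y at s                                    ≈⟨ *-identityˡ _ ⟨
      1# * (z at s₁ * y at s)                             ≈⟨ *-congʳ (*-inverseʳ ys₁≉0) ⟨
      y at s₁ * inv (y at s₁) * (z at s₁ * y at s)        ≈⟨ solve 4 (λ a b c d → a :* b :* (c :* d) := a :* (b :* c :* d)) refl _ _ _ _ ⟩
      y at s₁ * (inv (y at s₁) * z at s₁ * y at s)        ∎)
      where
      h = linear (y at s₁) z (- (z at s₁)) y

      h-at : ∀ s → h at s ≈ y at s₁ * z at s + - (z at s₁ * y at s)
      h-at s = trans (linear-at (y at s₁) z (- (z at s₁)) y s)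
        (solve 3 (λ a b c → a :+ (:- b) :* c := a :+ (:- (b :* c))) refl (y at s₁ * z at s) (z at s₁) (y at s))

      h-zero : ∀ {s} → s ∈ S → y at s ≈ 0# → h at s ≈ 0#
      h-zero {s} s∈ ys≈0 = trans (h-at s) (trans
        (+-cong (*-congˡ (z≈0 s∈ ys≈0)) (-‿cong (*-congˡ ys≈0)))
        (solve 2 (λ a b → a :* con (ℤ.+ 0) :+ (:- (b :* con (ℤ.+ 0))) := con (ℤ.+ 0)) refl (y at s₁) (z at s₁)))

      hs₁≈0 : h at s₁ ≈ 0#
      hs₁≈0 = trans (h-at s₁) (solve 2 (λ a b → a :* b :+ (:- (b :* a)) := con (ℤ.+ 0)) refl (y at s₁) (z at s₁))

      -h = linear (- 1#) h 0# h

      -h-at : ∀ s → -h at s ≈ - (h at s)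
      -h-at s = trans (linear-at (- 1#) h 0# h s)
        (solve 1 (λ a → (:- con (ℤ.+ 1)) :* a :+ con (ℤ.+ 0) :* a := :- a) refl (h at s))

      -h≈0 : ∀ {s} → h at s ≈ 0# → -h at s ≈ 0#
      -h≈0 {s} hs≈0 = trans (-h-at s) (trans (-‿cong hs≈0) (solve 0 (:- con (ℤ.+ 0) := con (ℤ.+ 0)) refl))

      no-rotation : ¬ (∃[ y′ ] Valid S y′ × zeros S y ℕ.< zeros S y′)
      no-rotation (y′ , Y′ , more) = ℕ.<⇒≱ more (maximal Y′)

      h≥0 : ∀ {s} → s ∈ S → 0# ≤ h at s
      h≥0 {s} s∈ = decidable-stable (0# ≤? h at s) λ hs≱0 →
        no-rotation (rotate Y h h-zero s₁∈ ys₁≉0 hs₁≈0 s∈ hs≱0)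

      h≤0 : ∀ {s} → s ∈ S → h at s ≤ 0#
      h≤0 {s} s∈ = 0≤-x⇒x≤0 (decidable-stable (0# ≤? - (h at s)) λ -hs≱0 →
        no-rotation (rotate Y -h (λ s∈ → -h≈0 ∘ h-zero s∈) s₁∈ ys₁≉0 (-h≈0 hs₁≈0) s∈
          (-hs≱0 ∘ ≤-respʳ-≈ (-h-at s))))

      h≈0 : ∀ {s} → s ∈ S → h at s ≈ 0#
      h≈0 s∈ = ≤-antisym (h≤0 s∈) (h≥0 s∈)

  facet-realised : ∀ {S y f χ} → Facet S y → Realises f χ →
    (∀ {s} → s ∈ S → (χ s ≡ false → y at s ≈ 0#) × (y at s ≈ 0# → χ s ≡ false)) → Facet S f
  facet-realised {S} {y} {f} {χ} Y f≈χ correct = record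
    { nonNegative = λ {s} _ → realises-nonNegative f≈χ s
    ; nonZero     = s₁ , s₁∈ , fs₁≉0
    ; multiples   = multiples
    }
    where
    s₁    = proj₁ (Facet.nonZero Y)
    s₁∈   = proj₁ (proj₂ (Facet.nonZero Y))
    ys₁≉0 = proj₂ (proj₂ (Facet.nonZero Y))

    fs₁≉0 : ¬ f at s₁ ≈ 0#
    fs₁≉0 fs₁≈0 = ys₁≉0 (proj₁ (correct s₁∈) (≈0⇒false f≈χ fs₁≈0))

    multiples : ∀ z → (∀ {s} → s ∈ S → f at s ≈ 0# → z at s ≈ 0#) →
                ∃[ μ ] (∀ {s} → s ∈ S → z at s ≈ μ * f at s)
    multiples z z≈0
      with ν , f≈νy ← Facet.multiples Y f (λ s∈ ys≈0 → false⇒≈0 f≈χ (proj₂ (correct s∈) ys≈0))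
      with μ , z≈μy ← Facet.multiples Y z
             (λ s∈ ys≈0 → z≈0 s∈ (false⇒≈0 f≈χ (proj₂ (correct s∈) ys≈0)))
      -- From f = ν y and f = 1 at s₁ it follows that ν is inverse to y at s₁, so that μ y = μ y(s₁)
      -- f.
      = μ * y at s₁ , λ {s} s∈ → begin
        z at s                             ≈⟨ z≈μy s∈ ⟩
        μ * y at s                         ≈⟨ *-identityʳ _ ⟨
        μ * y at s * 1#                    ≈⟨ *-congˡ (true⇒≈1 f≈χ (≉0⇒true f≈χ fs₁≉0)) ⟨
        μ * y at s * f at s₁               ≈⟨ *-congˡ (f≈νy s₁∈) ⟩
        μ * y at s * (ν * y at s₁)         ≈⟨ solve 4 (λ a b c d → a :* b :* (c :* d) := a :* d :* (c :* b)) refl μ (y at s) ν (y at s₁) ⟩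
        μ * y at s₁ * (ν * y at s)         ≈⟨ *-congˡ (f≈νy s∈) ⟨
        μ * y at s₁ * f at s               ∎

  record LargeFacet (S : List X) : Set (c ⊔ ℓ₁ ⊔ ℓ₂) where
    field
      {functional} : Point N
      {χ}          : X → Bool
      functional≈χ : Realises functional χ
      facet        : Facet S functional
      -- Claimed only for a nonempty zero set: if f is 1 throughout S, then 1 - f is zero on S and
      -- does not compete.
      large        : ∀ {s} → s ∈ part χ false S → length (part χ true S) ℕ.≤ length (part χ false S)

  -- The functional `one` is a first competitor. The competitor 1 - f has as zeros the points where
  -- f is 1, so these are no more numerous than the zeros of the maximiser y, which are those of f.
  largeFacet : ∀ {S s} → s ∈ S → TwoLevelOn S → ¬ ¬ LargeFacet S
  largeFacet {S} {s₀} s₀∈ twoLevel none =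
    ¬¬-maximum (λ k → ∃[ y ] Valid S y × zeros S y ≡ k) (length S) bounded _ (one , one-valid , ≡.refl)
      λ where (_ , (y , Y , ≡.refl) , max) → none (build y Y λ Z → max _ (_ , Z , ≡.refl))
    where
    bounded : ∀ k → (∃[ y ] Valid S y × zeros S y ≡ k) → k ℕ.≤ length S
    bounded _ (y , _ , ≡.refl) = length-filter (λ s → y at s ≟ 0#) S

    one-valid : Valid S one
    one-valid = valid (λ {s} _ → ≤-respʳ-≈ (sym (one≈1 s)) 0≤1)
                      (s₀ , s₀∈ , λ ≈0 → 1≉0 (trans (sym (one≈1 s₀)) ≈0))

    build : ∀ y → Valid S y → (∀ {z} → Valid S z → zeros S z ℕ.≤ zeros S y) → LargeFacet S
    build y Y max
      with Fy ← maximal-valid⇒facet Y max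
      with χ , (f , f≈χ) , correct ← twoLevel y Fy
      = record
      { functional≈χ = f≈χ
      ; facet = facet-realised Fy f≈χ correct
      ; large = λ {s} s∈₀ → let s∈ , χs≡false = ∈-part⁻ χ S s∈₀ in ℕ.≤-trans
        (length-filter-mono-≤ (λ s → χ s Bool.≟ true) (λ s → f̄ at s ≟ 0#) S
          λ {s} _ χs≡true → false⇒≈0 f̄≈χ̄ (≡.cong not χs≡true))
        (ℕ.≤-trans
          (max (valid (λ {s} _ → realises-nonNegative f̄≈χ̄ s)
                 (s , s∈ , λ f̄s≈0 → contradiction
                   (≡.trans (≡.sym (≡.cong not χs≡false)) (≈0⇒false f̄≈χ̄ f̄s≈0)) λ ())))
          (length-filter-mono-≤ (λ s → y at s ≟ 0#) (λ s → χ s Bool.≟ false) S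
            λ s∈ → proj₂ (correct s∈)))
      }
      where
      f̄   = linear 1# one (- 1#) f
      f̄≈χ̄ = realises-not f≈χ

-- Counting 0/1 functionals on a two-level set

module Counting {c ℓ₁ ℓ₂} (ℝ : RealField c ℓ₁ ℓ₂) {N : ℕ} {X : Set}
  (x : X → Polytopes.Point ℝ N) (one : Polytopes.Point ℝ N)
  (one≈1 : ∀ s → RealField._≈_ ℝ (Polytopes._·_ ℝ one (x s)) (RealField.1# ℝ)) where

  open RealField ℝ hiding (zero)
  open Polytopes ℝ
  open OrderedField ℝ
  open LinearAlgebra ℝ
  open Functionals ℝ x one one≈1
  open Solver using (solve; _:=_; _:+_; _:*_; _:-_; :-_; con)
  open import Relation.Binary.Reasoning.Setoid (RealField.setoid ℝ)

  open Realises

  1+x≉0 : ∀ {x} → 0# ≤ x → ¬ 1# + x ≈ 0#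
  1+x≉0 0≤x 1+x≈0 = 1≉0 (x+y≈0⇒x≈0 0≤1 0≤x 1+x≈0)

  indicator-injective : ∀ p q → indicator p ≈ indicator q → p ≡ q
  indicator-injective true  true  _   = ≡.refl
  indicator-injective true  false 1≈0 = contradiction 1≈0 1≉0
  indicator-injective false true  0≈1 = contradiction (sym 0≈1) 1≉0
  indicator-injective false false _   = ≡.refl

  -- The differences 1 and -1 arise only as 1 - 0 and 0 - 1. The order excludes coincidences such as
  -- 1 = -1.
  indicator-difference : ∀ p q u v → indicator p - indicator q ≈ indicator u - indicator v →
                         u ≢ v → p ≡ u
  indicator-difference true  q true  v     _  _   = ≡.refl
  indicator-difference false q false v     _  _   = ≡.refl
  indicator-difference _     q true  true  _  u≢v = contradiction ≡.refl u≢v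
  indicator-difference _     q false false _  u≢v = contradiction ≡.refl u≢v
  indicator-difference true  q false true  eq _   = contradiction (begin
    1# + indicator (not q)      ≈⟨ +-congˡ (complement q) ⟩
    1# + (1# - indicator q)     ≈⟨ +-congˡ eq ⟩
    1# + (0# - 1#)              ≈⟨ solve 0 (con (ℤ.+ 1) :+ (con (ℤ.+ 0) :- con (ℤ.+ 1)) := con (ℤ.+ 0)) refl ⟩
    0#                          ∎) (1+x≉0 (0≤indicator (not q)))
    where
    complement : ∀ b → indicator (not b) ≈ 1# - indicator b
    complement true  = sym (-‿inverseʳ 1#)
    complement false = solve 0 (con (ℤ.+ 1) := con (ℤ.+ 1) :- con (ℤ.+ 0)) refl
  indicator-difference false q true  false eq _   = contradiction (begin
    1# + indicator q            ≈⟨ solve 1 (λ q → con (ℤ.+ 1) :+ q := (con (ℤ.+ 1) :- con (ℤ.+ 0)) :+ q) refl (indicator q) ⟩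
    (1# - 0#) + indicator q     ≈⟨ +-congʳ eq ⟨
    (0# - indicator q) + indicator q
                                ≈⟨ solve 1 (λ q → (con (ℤ.+ 0) :- q) :+ q := con (ℤ.+ 0)) refl (indicator q) ⟩
    0#                          ∎) (1+x≉0 (0≤indicator q))

  rank-positive : ∀ {S r s} → s ∈ S → RankAtMost S r → 1 ℕ.≤ r
  rank-positive {s = s} s∈ rank =
    rank (s ∷ᵛ []ᵛ) ((one , (λ ≈0 → 1≉0 (trans (sym (one≈1 s)) ≈0)) , λ ()) , tt) λ { zero → s∈ }

  difference : Point N → Point N → Point N
  difference y z = linear 1# y (- 1#) z

  difference-at : ∀ y z s → difference y z at s ≈ y at s - z at s
  difference-at y z s = trans (linear-at 1# y (- 1#) z s)
    (solve 2 (λ a b → con (ℤ.+ 1) :* a :+ (:- con (ℤ.+ 1)) :* b := a :- b) refl (y at s) (z at s))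

  x-y≈0⇒x≈y : ∀ {x y} → x - y ≈ 0# → x ≈ y
  x-y≈0⇒x≈y {x} {y} x-y≈0 = trans
    (solve 2 (λ x y → x := (x :- y) :+ y) refl x y) (trans (+-congʳ x-y≈0) (+-identityˡ y))

  x≈y⇒x-y≈0 : ∀ {x y} → x ≈ y → x - y ≈ 0#
  x≈y⇒x-y≈0 {y = y} x≈y = trans (+-congʳ x≈y) (-‿inverseʳ y)

  -- The 0/1 functions span all functionals on a two-level set, so if they identify t
  -- and t′ then so does every functional: this is proved for functionals up to
  -- their values on S, by induction on the rank.
  span-identifies : ∀ r S → TwoLevelOn S → RankAtMost S r →
    ∀ {t t′} → (∀ χ → Binary χ → χ t ≡ χ t′) →
    ∀ y → ¬ ¬ (∃[ z ] (∀ {s} → s ∈ S → y at s ≈ z at s) × z at t ≈ z at t′)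
  span-identifies r [] _ _ {t} {t′} _ y none = none (linear 0# y 0# y , (λ ()) , trans (zero-at t) (sym (zero-at t′)))
    where
    zero-at : ∀ s → linear 0# y 0# y at s ≈ 0#
    zero-at s = trans (linear-at 0# y 0# y s)
      (solve 1 (λ a → con (ℤ.+ 0) :* a :+ con (ℤ.+ 0) :* a := con (ℤ.+ 0)) refl (y at s))
  span-identifies zero (s ∷ S) _ rank _ _ _ = contradiction (rank-positive (here ≡.refl) rank) λ ()
  span-identifies (suc r) S@(_ ∷ _) twoLevel rank {t} {t′} same y none =
    largeFacet (here ≡.refl) twoLevel λ F → let open LargeFacet F in
    span-identifies r (part χ false S) (twoLevelOn-facet functional≈χ facet twoLevel)
      (rankAtMost-facet functional≈χ facet rank) same y
      λ (z , y≈z , zt≈zt′) →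
        let ν , y-z≈νf = Facet.multiples facet (difference y z) (λ s∈ fs≈0 →
              trans (difference-at y z _) (x≈y⇒x-y≈0 (y≈z (∈-part⁺ χ s∈ (≈0⇒false functional≈χ fs≈0)))))
        in none (linear 1# z ν functional
          , (λ {s} s∈ → begin
              y at s                          ≈⟨ solve 2 (λ a b → a := con (ℤ.+ 1) :* b :+ (a :- b)) refl (y at s) (z at s) ⟩
              1# * z at s + (y at s - z at s)       ≈⟨ +-congˡ (difference-at y z s) ⟨
              1# * z at s + difference y z at s     ≈⟨ +-congˡ (y-z≈νf s∈) ⟩
              1# * z at s + ν * functional at s     ≈⟨ linear-at 1# z ν functional s ⟨
              linear 1# z ν functional at s   ∎)
          , (begin
              linear 1# z ν functional at t   ≈⟨ linear-at 1# z ν functional t ⟩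
              1# * z at t + ν * functional at t     ≈⟨ +-cong (*-congˡ zt≈zt′) (*-congˡ (ft≈ft′ F)) ⟩
              1# * z at t′ + ν * functional at t′   ≈⟨ linear-at 1# z ν functional t′ ⟨
              linear 1# z ν functional at t′  ∎))
    where
    ft≈ft′ : ∀ F → LargeFacet.functional {S} F at t ≈ LargeFacet.functional F at t′
    ft≈ft′ F = trans (value functional≈χ t) (trans
      (reflexive (≡.cong indicator (same χ (_ , functional≈χ)))) (sym (value functional≈χ t′)))
      where open LargeFacet F

  -- Stated negatively because a separating functional comes out of undecidable choices and is known
  -- only up to double negation.
  Separated : X → X → Set (c ⊔ ℓ₁)
  Separated t t′ = ¬ (∀ χ → Binary χ → χ t ≡ χ t′)

  -- Both points lie in S, where every functional y coincides with some z in the span of the 0/1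
  -- functionals; what these do not distinguish, y does not distinguish either.
  separated : ∀ {S t t′} → TwoLevelOn S → t ∈ S → t′ ∈ S → ¬ (∀ y → y at t ≈ y at t′) → Separated t t′
  separated {S} {t} {t′} twoLevel t∈ t′∈ distinct same = distinct λ y →
    decidable-stable (y at t ≟ y at t′) λ differ →
    span-identifies N S twoLevel (rankAtMost-dimension S) same y λ (z , y≈z , zt≈zt′) →
    differ (trans (y≈z t∈) (trans zt≈zt′ (sym (y≈z t′∈))))

  vanishing : ∀ {χ} → Binary χ → ∀ b →
              ∃[ y ] (∀ {s} → χ s ≡ b → y at s ≈ 0#) × (∀ {s} → χ s ≢ b → ¬ y at s ≈ 0#)
  vanishing (f , f≈χ) false = f , false⇒≈0 f≈χ , λ χs≢b fs≈0 → χs≢b (≈0⇒false f≈χ fs≈0)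
  vanishing (f , f≈χ) true  = _ , (λ eq → false⇒≈0 f̄≈χ̄ (≡.cong not eq)) ,
    λ χs≢b fs≈0 → χs≢b (Bool.not-injective (≈0⇒false f̄≈χ̄ fs≈0))
    where f̄≈χ̄ = realises-not f≈χ

  -- A 0/1 functional that separates two points of T splits it. The larger class is kept and a point
  -- of the other is put in front, so each new member of the system accounts for a factor of 2. A
  -- single point already forms a system of length 1 by means of `one`, which is the origin of the
  -- factor 2 on the left.
  separated⇒triangular : ∀ fuel T → length T ℕ.≤ fuel → 1 ℕ.≤ length T → AllPairs Separated T →
    ¬ ¬ (∃[ k ] Σ[ xs ∈ Vector X k ] Triangular xs × (∀ i → xs i ∈ T) × length T ℕ.* 2 ℕ.≤ 2 ℕ.^ k)
  separated⇒triangular fuel (t ∷ []) _ _ _ none = none (1 , t ∷ᵛ []ᵛ ,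
    ((one , (λ ≈0 → 1≉0 (trans (sym (one≈1 t)) ≈0)) , λ ()) , tt) , (λ { zero → here ≡.refl }) , ℕ.≤-refl)
  separated⇒triangular (suc fuel) T@(t ∷ t′ ∷ _) T≤ _ T-sep@((t-sep ∷ _) ∷ _) none =
    t-sep λ χ binary → decidable-stable (χ t Bool.≟ χ t′) (split χ binary)
    where
    split : ∀ χ → Binary χ → ¬ (χ t ≢ χ t′)
    split χ binary χt≢χt′
      with b , smaller ← larger-part χ T
      with y , y≈0 , y≉0 ← vanishing binary b
      = separated⇒triangular fuel (part χ b T)
          (ℕ.s≤s⁻¹ (ℕ.≤-trans (length-part-< χ T (proj₁ (proj₂ outside)) (proj₂ (proj₂ outside))) T≤))
          positive (AllPairs.filter⁺ (λ s → χ s Bool.≟ b) T-sep)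
          λ (k , xs , tri , xs∈ , T≤2^k) → none
            ( suc k , proj₁ outside ∷ᵛ xs
            , ((y , y≉0 (proj₂ (proj₂ outside)) , λ i → y≈0 (proj₂ (∈-part⁻ χ T (xs∈ i)))) , tri)
            , (λ { zero → proj₁ (proj₂ outside) ; (suc i) → proj₁ (∈-part⁻ χ T (xs∈ i)) })
            , doubled {k} T≤2^k)
      where
      outside : ∃[ u ] u ∈ T × χ u ≢ b
      outside with χ t Bool.≟ b
      ... | no χt≢b  = t , here ≡.refl , χt≢b
      ... | yes χt≡b = t′ , there (here ≡.refl) , λ χt′≡b → χt≢χt′ (≡.trans χt≡b (≡.sym χt′≡b))

      T≤2T : length T ℕ.≤ 2 ℕ.* length (part χ b T)
      T≤2T = ℕ.≤-trans (ℕ.≤-reflexive (length-part χ b T)) (ℕ.≤-trans (ℕ.+-monoʳ-≤ _ smaller)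
        (ℕ.≤-reflexive (≡.cong (length (part χ b T) ℕ.+_) (≡.sym (ℕ.+-identityʳ _)))))

      positive : 1 ℕ.≤ length (part χ b T)
      positive with length (part χ b T) | T≤2T
      ... | suc _ | _ = ℕ.s≤s ℕ.z≤n

      doubled : ∀ {k} → length (part χ b T) ℕ.* 2 ℕ.≤ 2 ℕ.^ k → length T ℕ.* 2 ℕ.≤ 2 ℕ.^ suc k
      doubled {k} T_b≤ = ℕ.≤-trans (ℕ.*-monoˡ-≤ 2 T≤2T)
        (ℕ.≤-trans (ℕ.≤-reflexive (ℕ.*-assoc 2 (length (part χ b T)) 2)) (ℕ.*-monoʳ-≤ 2 {length (part χ b T) ℕ.* 2} {2 ℕ.^ k} T_b≤))

  Binaries : List (X → Bool) → Set (c ⊔ ℓ₁)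
  Binaries D = ∀ {χ} → χ ∈ D → Binary χ

  -- Splitting D by the values at a point s where two members differ prolongs the system by s.
  agreeing-bound : ∀ fuel {S r} → RankAtMost S r → ∀ D → length D ℕ.≤ fuel →
    Binaries D → AllPairs (Differ S) D → ∀ {k} (xs : Vector X k) → Triangular xs → (∀ i → xs i ∈ S) →
    (∀ {χ χ′} → χ ∈ D → χ′ ∈ D → ∀ i → χ (xs i) ≡ χ′ (xs i)) → length D ℕ.* 2 ℕ.^ k ℕ.≤ 2 ℕ.^ r
  agreeing-bound fuel rank [] _ _ _ _ _ _ _ = ℕ.z≤n
  agreeing-bound fuel rank (χ ∷ []) _ _ _ xs tri xs∈ _ = ℕ.≤-trans
    (ℕ.≤-reflexive (ℕ.*-identityˡ _)) (ℕ.^-monoʳ-≤ 2 (rank xs tri xs∈))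
  agreeing-bound (suc fuel) {S} {r} rank D@(χ ∷ χ′ ∷ _) D≤ binaries D-differ@((χ-differ ∷ _) ∷ _) {k} xs tri xs∈ agree
    with s , s∈ , χs≢χ′s ← differ-at S χ-differ
    with f , f≈χ ← binaries (here ≡.refl) | f′ , f′≈χ′ ← binaries (there (here ≡.refl))
    = halving {length D} {length (D′ true)} {length (D′ false)} {2 ℕ.^ k} (length-part (λ χ → χ s) true D) (half true) (half false)
    where
    D′ : Bool → List (X → Bool)
    D′ b = part (λ χ → χ s) b D

    f-f′≈0 : ∀ {u} → χ u ≡ χ′ u → difference f f′ at u ≈ 0#
    f-f′≈0 {u} eq = trans (difference-at f f′ u) (x≈y⇒x-y≈0
      (trans (value f≈χ u) (trans (reflexive (≡.cong indicator eq)) (sym (value f′≈χ′ u)))))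

    -- All of D agrees on xs, so the difference of two members that differ at s is a witness for s.
    extended : Triangular (s ∷ᵛ xs)
    extended = (difference f f′ , (λ ≈0 → χs≢χ′s (indicator-injective (χ s) (χ′ s)
      (trans (sym (value f≈χ s)) (trans (x-y≈0⇒x≈y (trans (sym (difference-at f f′ s)) ≈0)) (value f′≈χ′ s))))) ,
      λ i → f-f′≈0 (agree (here ≡.refl) (there (here ≡.refl)) i)) , tri

    outside : ∀ b → ∃[ ψ ] ψ ∈ D × ψ s ≢ b
    outside b with χ s Bool.≟ b
    ... | no χs≢b  = χ , here ≡.refl , χs≢b
    ... | yes χs≡b = χ′ , there (here ≡.refl) , λ χ′s≡b → χs≢χ′s (≡.trans χs≡b (≡.sym χ′s≡b))

    half : ∀ b → length (D′ b) ℕ.* 2 ℕ.^ suc k ℕ.≤ 2 ℕ.^ r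
    half b = agreeing-bound fuel rank (D′ b)
      (ℕ.s≤s⁻¹ (ℕ.≤-trans (length-part-< (λ χ → χ s) D (proj₁ (proj₂ (outside b))) (proj₂ (proj₂ (outside b)))) D≤))
      (λ χ∈ → binaries (proj₁ (∈-part⁻ (λ χ → χ s) D χ∈))) (AllPairs.filter⁺ (λ χ → χ s Bool.≟ b) D-differ)
      (s ∷ᵛ xs) extended (λ { zero → s∈ ; (suc i) → xs∈ i })
      λ { χ∈ χ′∈ zero    → ≡.trans (proj₂ (∈-part⁻ (λ χ → χ s) D χ∈)) (≡.sym (proj₂ (∈-part⁻ (λ χ → χ s) D χ′∈)))
        ; χ∈ χ′∈ (suc i) → agree (proj₁ (∈-part⁻ (λ χ → χ s) D χ∈)) (proj₁ (∈-part⁻ (λ χ → χ s) D χ′∈)) i }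

  -- T contains k independent points with 2 |T| ≤ 2ᵏ. Since D agrees on them, only r - k further
  -- points can be added to tell its members apart, whence |D| ≤ 2ʳ⁻ᵏ.
  orthogonal-bound : ∀ {S r} → RankAtMost S r → ∀ T → (∀ {t} → t ∈ T → t ∈ S) → AllPairs Separated T →
    ∀ D → Binaries D → AllPairs (Differ S) D →
    (∀ {χ χ′} → χ ∈ D → χ′ ∈ D → ∀ {t} → t ∈ T → χ t ≡ χ′ t) →
    length T ℕ.* length D ℕ.* 2 ℕ.≤ 2 ℕ.^ r
  orthogonal-bound rank [] _ _ _ _ _ _ = ℕ.z≤n
  orthogonal-bound {r = r} rank T@(_ ∷ _) T⊆S T-sep D binaries D-differ agree =
    decidable-stable (_ ℕ.≤? _) λ exceeds →
    separated⇒triangular (length T) T ℕ.≤-refl (ℕ.s≤s ℕ.z≤n) T-sep λ (k , xs , tri , xs∈ , T≤2^k) →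
    exceeds (*-bound (length T) (length D) T≤2^k
      (agreeing-bound (length D) rank D ℕ.≤-refl binaries D-differ
        xs tri (T⊆S ∘ xs∈) (λ χ∈ χ′∈ i → agree χ∈ χ′∈ (xs∈ i))))

  -- Functions that agree on a facet, and the induction step

  module _ {S f χ} (f≈χ : Realises f χ) (F : Facet S f) where

    open Facet F

    private
      s₁    = proj₁ nonZero
      s₁∈   = proj₁ (proj₂ nonZero)
      χs₁≡true : χ s₁ ≡ true
      χs₁≡true = ≉0⇒true f≈χ (proj₂ (proj₂ nonZero))

    module _ {ψ ω} (ψ-binary : Binary ψ) (ω-binary : Binary ω)
             (agree : Agree (part χ false S) ψ ω) where

      private
        g    = proj₁ ψ-binary
        g≈ψ  = proj₂ ψ-binary
        g′   = proj₁ ω-binary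
        g′≈ω = proj₂ ω-binary

        difference-indicator : ∀ s → difference g g′ at s ≈ indicator (ψ s) - indicator (ω s)
        difference-indicator s = trans (difference-at g g′ s) (+-cong (value g≈ψ s) (-‿cong (value g′≈ω s)))

        ν : ∃[ ν ] (∀ {s} → s ∈ S → difference g g′ at s ≈ ν * f at s)
        ν = multiples (difference g g′) λ {s} s∈ fs≈0 → trans (difference-indicator s)
          (x≈y⇒x-y≈0 (reflexive (≡.cong indicator (agree (∈-part⁺ χ s∈ (≈0⇒false f≈χ fs≈0))))))

      -- The difference of the two functionals vanishes on the zeros of f, so it is a multiple of f,
      -- and f is 1 off the facet.
      difference-constant : ∀ {s} → s ∈ S → χ s ≡ true →
                            indicator (ψ s) - indicator (ω s) ≈ indicator (ψ s₁) - indicator (ω s₁)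
      difference-constant {s} s∈ χs≡true = begin
        indicator (ψ s) - indicator (ω s)       ≈⟨ difference-indicator s ⟨
        difference g g′ at s                    ≈⟨ proj₂ ν s∈ ⟩
        proj₁ ν * f at s                        ≈⟨ *-congˡ (trans (true⇒≈1 f≈χ χs≡true) (sym (true⇒≈1 f≈χ χs₁≡true))) ⟩
        proj₁ ν * f at s₁                       ≈⟨ proj₂ ν s₁∈ ⟨
        difference g g′ at s₁                   ≈⟨ difference-indicator s₁ ⟩
        indicator (ψ s₁) - indicator (ω s₁)     ∎

      agree-extends : ψ s₁ ≡ ω s₁ → Agree S ψ ω
      agree-extends eq {s} s∈ with χ s in χs
      ... | false = agree (∈-part⁺ χ s∈ χs)
      ... | true  = indicator-injective (ψ s) (ω s) (x-y≈0⇒x≈y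
        (trans (difference-constant s∈ χs) (x≈y⇒x-y≈0 (reflexive (≡.cong indicator eq)))))

      constant-off-facet : ψ s₁ ≢ ω s₁ → ∀ {s} → s ∈ part χ true S → ψ s ≡ ψ s₁
      constant-off-facet ≢ {s} s∈ = let s∈S , χs≡true = ∈-part⁻ χ S s∈ in
        indicator-difference (ψ s) (ω s) (ψ s₁) (ω s₁) (difference-constant s∈S χs≡true) ≢

    -- Distinct functions on S that coincide on the facet differ everywhere off it, so each of
    -- the two classes of functions with a given value at s₁ restricts injectively to the facet. A restriction arising from both classes (collected in D) comes from a
    -- function that is constant off the facet.
    facet-step : ∀ {r} → RankAtMost S (suc r) → AllPairs Separated S →
      length (part χ true S) ℕ.≤ length (part χ false S) →
      (∀ L → Binaries L → AllPairs (Differ (part χ false S)) L →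
         length (part χ false S) ℕ.* length L ℕ.≤ r ℕ.* 2 ℕ.^ r) →
      ∀ L → Binaries L → AllPairs (Differ S) L →
      length S ℕ.* length L ℕ.≤ suc r ℕ.* 2 ℕ.^ suc r
    facet-step {r} rank S-sep large ih L binaries L-differ
      -- Taking the larger class as the base gives δ ≤ l, because `D` is drawn from the smaller
      -- class.
      with b , smaller ← larger-part (λ ψ → ψ s₁) L
      = ≡.subst₂ (λ m n → m ℕ.* n ℕ.≤ suc r ℕ.* 2 ℕ.^ suc r)
          (≡.sym (length-part χ false S)) (≡.sym length-L)
          (rearrangement r (2 ℕ.^ r) large D≤L′
            (ih L′ L′-binaries L′-differ)
            (orthogonal-bound rank (part χ true S) (λ t∈ → proj₁ (∈-part⁻ χ S t∈))
              (AllPairs.filter⁺ (λ s → χ s Bool.≟ true) S-sep)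
              D (λ ψ∈ → binaries (proj₁ (L⁻ (not b) (proj₁ (D⁻ ψ∈))))) D-differ D-agree))
      where
      value₁ : (X → Bool) → Bool
      value₁ ψ = ψ s₁

      S₀ = part χ false S

      repeated? : ∀ ψ → Dec (Any (Agree S₀ ψ) (part value₁ b L))
      repeated? ψ = Any.any? (agree? S₀ ψ) (part value₁ b L)

      repeated : (X → Bool) → Bool
      repeated ψ = does (repeated? ψ)

      -- `L′` contains exactly one function for each restriction to the facet, so l is its length;
      -- `D` collects the second extensions, so δ is its length.
      R  = part repeated false (part value₁ (not b) L)
      D  = part repeated true  (part value₁ (not b) L)
      L′ = part value₁ b L ++ R

      L⁻ : ∀ b {ψ} → ψ ∈ part value₁ b L → ψ ∈ L × ψ s₁ ≡ b
      L⁻ b = ∈-part⁻ value₁ L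

      D⁻ : ∀ {ψ} → ψ ∈ D → ψ ∈ part value₁ (not b) L × Any (Agree S₀ ψ) (part value₁ b L)
      D⁻ {ψ} ψ∈ = let ψ∈L , eq = ∈-part⁻ repeated (part value₁ (not b) L) ψ∈ in
        ψ∈L , doesTrue⇒ (repeated? ψ) eq

      R⁻ : ∀ {ψ} → ψ ∈ R → ψ ∈ part value₁ (not b) L × ¬ Any (Agree S₀ ψ) (part value₁ b L)
      R⁻ {ψ} ψ∈ = let ψ∈L , eq = ∈-part⁻ repeated (part value₁ (not b) L) ψ∈ in
        ψ∈L , doesFalse⇒ (repeated? ψ) eq

      length-L : length L ≡ length L′ ℕ.+ length D
      length-L = ≡.trans (length-part value₁ b L) (≡.trans
        (≡.cong (length (part value₁ b L) ℕ.+_) (length-part repeated false (part value₁ (not b) L)))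
        (≡.trans (≡.sym (ℕ.+-assoc (length (part value₁ b L)) (length R) (length D)))
          (≡.cong (ℕ._+ length D) (≡.sym (length-++ (part value₁ b L))))))

      D≤L′ : length D ℕ.≤ length L′
      D≤L′ = ℕ.≤-trans (length-filter (λ ψ → repeated ψ Bool.≟ true) (part value₁ (not b) L))
        (ℕ.≤-trans smaller (ℕ.≤-trans (ℕ.m≤m+n _ (length R))
          (ℕ.≤-reflexive (≡.sym (length-++ (part value₁ b L))))))

      L′-binaries : Binaries L′
      L′-binaries ψ∈ with ∈-++⁻ (part value₁ b L) ψ∈
      ... | inj₁ ψ∈L = binaries (proj₁ (L⁻ b ψ∈L))
      ... | inj₂ ψ∈R = binaries (proj₁ (L⁻ (not b) (proj₁ (R⁻ ψ∈R))))

      D-differ : AllPairs (Differ S) D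
      D-differ = AllPairs.filter⁺ (λ ψ → repeated ψ Bool.≟ true)
        (AllPairs.filter⁺ (λ ψ → ψ s₁ Bool.≟ not b) L-differ)

      part-differ : ∀ b → AllPairs (Differ S₀) (part value₁ b L)
      part-differ b = AllPairs-map-∈ (λ ψ∈ ω∈ differ agree →
        let ψ∈L , ψs₁≡b = L⁻ b ψ∈ ; ω∈L , ωs₁≡b = L⁻ b ω∈ in
        differ (agree-extends (binaries ψ∈L) (binaries ω∈L) agree (≡.trans ψs₁≡b (≡.sym ωs₁≡b))))
        (AllPairs.filter⁺ (λ ψ → ψ s₁ Bool.≟ b) L-differ)

      L′-differ : AllPairs (Differ S₀) L′
      L′-differ = AllPairs.++⁺ (part-differ b)
        (AllPairs.filter⁺ (λ ψ → repeated ψ Bool.≟ false) (part-differ (not b)))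
        (All.tabulate λ ψ∈ → All.tabulate λ ω∈R agree →
          proj₂ (R⁻ ω∈R) (lose ψ∈ (λ s∈ → ≡.sym (agree s∈))))

      D-agree : ∀ {ψ ψ′} → ψ ∈ D → ψ′ ∈ D → ∀ {t} → t ∈ part χ true S → ψ t ≡ ψ′ t
      D-agree ψ∈ ψ′∈ t∈ = ≡.trans (D-constant ψ∈ t∈) (≡.sym (D-constant ψ′∈ t∈))
        where
        D-constant : ∀ {ψ} → ψ ∈ D → ∀ {t} → t ∈ part χ true S → ψ t ≡ not b
        D-constant ψ∈ t∈
          with ψ∈L , partner ← D⁻ ψ∈
          with ω , ω∈ , agree ← find partner
          with ψ∈L , ψs₁≡b̄ ← L⁻ (not b) ψ∈L | ω∈L , ωs₁≡b ← L⁻ b ω∈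
          = ≡.trans (constant-off-facet (binaries ψ∈L) (binaries ω∈L) agree
              (λ eq → Bool.not-¬ ≡.refl (≡.trans (≡.sym ωs₁≡b) (≡.trans (≡.sym eq) ψs₁≡b̄))) t∈) ψs₁≡b̄

  -- When f has no zeros on S, the condition in `multiples` is vacuous, so every functional is a
  -- multiple of f and hence constant on S. Then S has at most one point, and only the values 0 and
  -- 1 remain for L.
  empty-facet-bound : ∀ {S f χ} → Realises f χ → Facet S f → part χ false S ≡ [] →
    AllPairs Separated S → ∀ L → Binaries L → AllPairs (Differ S) L → length S ℕ.* length L ℕ.≤ 2
  empty-facet-bound {S} {f} {χ} f≈χ F empty S-sep L binaries L-differ =
    ℕ.*-mono-≤ S≤1 L≤2
    where
    open Facet F
    s₁ = proj₁ nonZero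

    f≈1 : ∀ {s} → s ∈ S → f at s ≈ 1#
    f≈1 {s} s∈ = true⇒≈1 f≈χ (≉0⇒true f≈χ λ fs≈0 → not-in-empty (∈-part⁺ χ s∈ (≈0⇒false f≈χ fs≈0)))
      where
      not-in-empty : ¬ s ∈ part χ false S
      not-in-empty s∈ with () ← ≡.subst (s ∈_) empty s∈

    S≤1 : length S ℕ.≤ 1
    S≤1 = AllPairs-absurd⇒length≤1 (λ {t} {t′} t∈ t′∈ sep → sep λ ψ (g , g≈ψ) →
      let ν , g≈νf = multiples g (λ s∈ fs≈0 → contradiction (trans (sym (f≈1 s∈)) fs≈0) 1≉0) in
      indicator-injective (ψ t) (ψ t′) (begin
        indicator (ψ t)     ≈⟨ value g≈ψ t ⟨
        g at t              ≈⟨ g≈νf t∈ ⟩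
        ν * f at t          ≈⟨ *-congˡ (trans (f≈1 t∈) (sym (f≈1 t′∈))) ⟩
        ν * f at t′         ≈⟨ g≈νf t′∈ ⟨
        g at t′             ≈⟨ value g≈ψ t′ ⟩
        indicator (ψ t′)    ∎)) S-sep

    half≤1 : ∀ b → length (part (λ ψ → ψ s₁) b L) ℕ.≤ 1
    half≤1 b = AllPairs-absurd⇒length≤1 (λ ψ∈ ω∈ differ →
      let ψ∈L , ψs₁≡b = ∈-part⁻ (λ ψ → ψ s₁) L ψ∈ ; ω∈L , ωs₁≡b = ∈-part⁻ (λ ψ → ψ s₁) L ω∈ in
      differ (agree-extends f≈χ F (binaries ψ∈L) (binaries ω∈L)
        (λ {s} s∈ → contradiction (≡.subst (s ∈_) empty s∈) λ ()) (≡.trans ψs₁≡b (≡.sym ωs₁≡b))))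
      (AllPairs.filter⁺ (λ ψ → ψ s₁ Bool.≟ b) L-differ)

    L≤2 : length L ℕ.≤ 2
    L≤2 = ℕ.≤-trans (ℕ.≤-reflexive (length-part (λ ψ → ψ s₁) true L)) (ℕ.+-mono-≤ (half≤1 true) (half≤1 false))

  scalar-product-bound : ∀ r {S} → TwoLevelOn S → RankAtMost S r → AllPairs Separated S →
    ∀ L → Binaries L → AllPairs (Differ S) L → length S ℕ.* length L ℕ.≤ r ℕ.* 2 ℕ.^ r
  scalar-product-bound r       {[]}        _ _ _ _ _ _ = ℕ.z≤n
  scalar-product-bound zero    {_ ∷ _}     _ rank _ _ _ _ = contradiction (rank-positive (here ≡.refl) rank) λ ()
  scalar-product-bound (suc r) {S@(_ ∷ _)} twoLevel rank S-sep L binaries L-differ =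
    decidable-stable (_ ℕ.≤? _) λ exceeds → largeFacet (here ≡.refl) twoLevel λ F → exceeds (bound F)
    where
    bound : LargeFacet S → length S ℕ.* length L ℕ.≤ suc r ℕ.* 2 ℕ.^ suc r
    bound F = by-cases (part χ false S) ≡.refl
      where
      open LargeFacet F

      by-cases : ∀ S₀ → part χ false S ≡ S₀ → length S ℕ.* length L ℕ.≤ suc r ℕ.* 2 ℕ.^ suc r
      by-cases [] empty = ℕ.≤-trans
        (empty-facet-bound functional≈χ facet empty S-sep L binaries L-differ)
        (ℕ.*-mono-≤ (ℕ.s≤s (ℕ.z≤n {r})) (ℕ.*-monoʳ-≤ 2 (ℕ.m^n>0 2 r)))
      by-cases (s ∷ _) eq = facet-step functional≈χ facet rank S-sep
        (large (≡.subst (s ∈_) (≡.sym eq) (here ≡.refl)))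
        (scalar-product-bound r (twoLevelOn-facet functional≈χ facet twoLevel)
          (rankAtMost-facet functional≈χ facet rank)
          (AllPairs.filter⁺ (λ s → χ s Bool.≟ false) S-sep))
        L binaries L-differ

  -- Opposite facets

  NonConstant : List X → (X → Bool) → Set
  NonConstant S ψ = (∃[ s ] s ∈ S × ψ s ≡ true) × (∃[ s ] s ∈ S × ψ s ≡ false)

  -- Two binary functions that coincide on the facet f but not on S are constant off f, so
  -- one of them vanishes there and is thus 0 or 1 − f; in the latter case the other is 1.
  module _ {S f χ} (f≈χ : Realises f χ) (F : Facet S f) (F̄ : Facet S (linear 1# one (- 1#) f)) where

    private
      s₁ = proj₁ (Facet.nonZero F)

    opposite-facet-agree : ∀ {ψ ω} → Binary ψ → Binary ω → NonConstant S ψ → NonConstant S ω →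
                           Agree (part χ false S) ψ ω → Agree S ψ ω
    opposite-facet-agree {ψ} {ω} ψ-binary ω-binary ψ-nonConst ω-nonConst agree = by-cases (ψ s₁) (ω s₁) ≡.refl ≡.refl
      where
      distinct : ∀ {b b′} → b ≡ false → b′ ≡ true → b ≢ b′
      distinct ≡.refl ≡.refl ()

      clash : ∀ {ψ ω} → Binary ψ → Binary ω → NonConstant S ψ → NonConstant S ω →
              Agree (part χ false S) ψ ω → ψ s₁ ≡ false → ω s₁ ≢ true
      clash {ψ} {ω} ψ-binary@(g , g≈ψ) ω-binary ((p , p∈ , ψp≡true) , _) (_ , (q , q∈ , ωq≡false)) agree ψs₁ ωs₁
        with s₂ , s₂∈ , f̄s₂≉0 ← Facet.nonZero F̄
        with μ , g≈μf̄ ← Facet.multiples F̄ g (λ {s} s∈ f̄s≈0 → false⇒≈0 g≈ψ (≡.trans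
               (constant-off-facet f≈χ F ψ-binary ω-binary agree (distinct ψs₁ ωs₁)
                 (∈-part⁺ χ s∈ (Bool.not-injective (≈0⇒false (realises-not f≈χ) f̄s≈0)))) ψs₁))
        = contradiction (≡.trans (≡.sym (ψ-true q∈ χq)) (≡.trans (agree (∈-part⁺ χ q∈ χq)) ωq≡false)) λ ()
        where
        off : ∀ {s} → s ∈ S → χ s ≡ true → ψ s ≡ false × ω s ≡ true
        off s∈ eq =
          ≡.trans (constant-off-facet f≈χ F ψ-binary ω-binary agree (distinct ψs₁ ωs₁) (∈-part⁺ χ s∈ eq)) ψs₁ ,
          ≡.trans (constant-off-facet f≈χ F ω-binary ψ-binary (≡.sym ∘ agree) (distinct ψs₁ ωs₁ ∘ ≡.sym) (∈-part⁺ χ s∈ eq)) ωs₁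

        on : ∀ {s} b → χ s ≡ b → (χ s ≢ true) → χ s ≡ false
        on true  eq ≢ = contradiction eq ≢
        on false eq _ = eq

        χp : χ p ≡ false
        χp = on (χ p) ≡.refl λ eq → contradiction (≡.trans (≡.sym ψp≡true) (proj₁ (off p∈ eq))) λ ()

        χq : χ q ≡ false
        χq = on (χ q) ≡.refl λ eq → contradiction (≡.trans (≡.sym (proj₂ (off q∈ eq))) ωq≡false) λ ()

        f̄≈1 : ∀ {s} → χ s ≡ false → linear 1# one (- 1#) f at s ≈ 1#
        f̄≈1 eq = true⇒≈1 (realises-not f≈χ) (≡.cong not eq)

        ψ-true : ∀ {s} → s ∈ S → χ s ≡ false → ψ s ≡ true
        ψ-true {s} s∈ eq = ≡.trans (indicator-injective (ψ s) (ψ p) (begin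
          indicator (ψ s)                   ≈⟨ value g≈ψ s ⟨
          g at s                            ≈⟨ g≈μf̄ s∈ ⟩
          μ * linear 1# one (- 1#) f at s   ≈⟨ *-congˡ (trans (f̄≈1 eq) (sym (f̄≈1 χp))) ⟩
          μ * linear 1# one (- 1#) f at p   ≈⟨ g≈μf̄ p∈ ⟨
          g at p                            ≈⟨ value g≈ψ p ⟩
          indicator (ψ p)                   ∎)) ψp≡true

      by-cases : ∀ b b′ → ψ s₁ ≡ b → ω s₁ ≡ b′ → Agree S ψ ω
      by-cases false true  ψs₁ ωs₁ = contradiction ωs₁
        (clash ψ-binary ω-binary ψ-nonConst ω-nonConst agree ψs₁)
      by-cases true  false ψs₁ ωs₁ = contradiction ψs₁
        (clash ω-binary ψ-binary ω-nonConst ψ-nonConst (≡.sym ∘ agree) ωs₁)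
      by-cases true  true  ψs₁ ωs₁ =
        agree-extends f≈χ F ψ-binary ω-binary agree (≡.trans ψs₁ (≡.sym ωs₁))
      by-cases false false ψs₁ ωs₁ =
        agree-extends f≈χ F ψ-binary ω-binary agree (≡.trans ψs₁ (≡.sym ωs₁))

-- Affine geometry in homogeneous coordinates

module Polytope {c ℓ₁ ℓ₂} (ℝ : RealField c ℓ₁ ℓ₂) where

  open RealField ℝ hiding (zero)
  open OrderedField ℝ
  open LinearAlgebra ℝ
  open Polytopes ℝ
  open Solver using (solve; _:=_; _:+_; _:*_; _:-_; :-_; con)
  open SemiringSum semiring using (sum; sum-cong-≋; *-distribˡ-sum; *-distribʳ-sum; ∑-distrib-+)
  open VectorEquality (RealField.setoid ℝ) using (_≋_)
  open import Relation.Binary.Reasoning.Setoid (RealField.setoid ℝ)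

  homogenise : ∀ {n} → Point n → Point (suc n)
  homogenise x = 1# ∷ᵛ x

  infixl 8 _∙_
  _∙_ : ∀ {n} → Point (suc n) → Point n → Carrier
  y ∙ x = y · homogenise x

  one : ∀ {n} → Point (suc n)
  one = 1# ∷ᵛ 0ᵛ

  ·-zeroˡ : ∀ {n} (x : Point n) → 0ᵛ · x ≈ 0#
  ·-zeroˡ x = sum-zero λ i → zeroˡ (x i)

  one≈1 : ∀ {n} (x : Point n) → one ∙ x ≈ 1#
  one≈1 x = trans (+-cong (*-identityˡ 1#) (·-zeroˡ x)) (+-identityʳ 1#)

  ·-congʳ : ∀ {n} (y : Point n) {x x′ : Point n} → x ≋ x′ → y · x ≈ y · x′
  ·-congʳ y x≋x′ = sum-cong-≋ λ i → *-congˡ (x≋x′ i)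

  ·-congˡ : ∀ {n} {y y′ : Point n} (x : Point n) → y ≋ y′ → y · x ≈ y′ · x
  ·-congˡ x y≋y′ = sum-cong-≋ λ i → *-congʳ (y≋y′ i)

  ·-comm : ∀ {n} (x y : Point n) → x · y ≈ y · x
  ·-comm x y = sum-cong-≋ λ i → *-comm (x i) (y i)

  homogenise-cong : ∀ {n} {x x′ : Point n} → x ≋ x′ → homogenise x ≋ homogenise x′
  homogenise-cong x≋x′ zero    = refl
  homogenise-cong x≋x′ (suc i) = x≋x′ i

  sum≈sum*1 : ∀ {n} (w : Vector Carrier n) → sum w ≈ sum (λ i → w i * 1#)
  sum≈sum*1 w = sum-cong-≋ λ i → sym (*-identityʳ (w i))

  module _ {n m} (w : Vector Carrier m) (p : Vector (Point n) m) where

    ∙-combination : ∀ {x} → sum w ≈ 1# → combination w p ≋ x →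
                    ∀ y → y ∙ x ≈ sum (λ i → w i * y ∙ p i)
    ∙-combination {x} ∑w≈1 wp≋x y = trans
      (·-congʳ y {homogenise x} {combination w (homogenise ∘ p)} λ { zero → trans (sym ∑w≈1) (sum≈sum*1 w) ; (suc j) → sym (wp≋x j) })
      (·-combination y w (homogenise ∘ p))

  affinelyIndependent⇒independent : ∀ {n m} {b : Vector (Point n) m} →
    AffinelyIndependent b → Independent (homogenise ∘ b)
  affinelyIndependent⇒independent ind w wb≈0 = ind w (trans (sum≈sum*1 w) (wb≈0 zero)) (wb≈0 ∘ suc)

  independent⇒affinelyIndependent : ∀ {n m} {b : Vector (Point n) m} →
    Independent (homogenise ∘ b) → AffinelyIndependent b
  independent⇒affinelyIndependent ind w ∑w≈0 wb≈0 = ind w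
    λ { zero → trans (sym (sum≈sum*1 w)) ∑w≈0 ; (suc j) → wb≈0 j }

  unit : ∀ {n} → Fin n → Point n
  unit zero    = 1# ∷ᵛ 0ᵛ
  unit (suc i) = 0# ∷ᵛ unit i

  unit-· : ∀ {n} (i : Fin n) (x : Point n) → unit i · x ≈ x i
  unit-· zero    x = trans (+-cong (*-identityˡ (x zero)) (·-zeroˡ (tail x))) (+-identityʳ (x zero))
  unit-· (suc i) x = trans (+-cong (zeroˡ (x zero)) (unit-· i (tail x))) (+-identityˡ (x (suc i)))

  sum-unit : ∀ {n} (i : Fin n) → sum (unit i) ≈ 1#
  sum-unit i = trans (sum≈sum*1 (unit i)) (unit-· i (λ _ → 1#))

  unit-nonNegative : ∀ {n} (i j : Fin n) → 0# ≤ unit i j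
  unit-nonNegative zero    zero    = 0≤1
  unit-nonNegative zero    (suc j) = ≤-refl
  unit-nonNegative (suc i) zero    = ≤-refl
  unit-nonNegative (suc i) (suc j) = unit-nonNegative i j

  vertex∈affineSpan : ∀ {n m} (b : Vector (Point n) m) i → affineSpan b (b i)
  vertex∈affineSpan b i = unit i , sum-unit i , λ j → unit-· i (λ i → b i j)

  vanishes-on-affineHull : ∀ {n} {F : Subset n} y → (∀ x → F x → y ∙ x ≈ 0#) →
                           ∀ x → affineHull F x → y ∙ x ≈ 0#
  vanishes-on-affineHull y y≈0 x (m , p , p∈F , w , ∑w≈1 , wp≋x) =
    trans (∙-combination w p ∑w≈1 wp≋x y) (sum-zero λ i → trans (*-congˡ (y≈0 (p i) (p∈F i))) (zeroʳ (w i)))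

  vanishes-on-affineSpan : ∀ {n m} {b : Vector (Point n) m} y → (∀ i → y ∙ b i ≈ 0#) →
                           ∀ x → affineSpan b x → y ∙ x ≈ 0#
  vanishes-on-affineSpan {b = b} y y≈0 x (w , ∑w≈1 , wb≋x) =
    trans (∙-combination w b ∑w≈1 wb≋x y) (sum-zero λ i → trans (*-congˡ (y≈0 i)) (zeroʳ (w i)))

  hasDimension⇒nonempty : ∀ {n k} {F : Subset n} → HasDimension F k → ∃[ x ] F x
  hasDimension⇒nonempty (b , _ , hull≐span) with proj₂ hull≐span (vertex∈affineSpan b zero)
  ... | zero  , p , _   , _ , 0≈1 , _ = contradiction (sym 0≈1) 1≉0
  ... | suc m , p , p∈F , _           = p zero , p∈F zero

  minimum-Fin : ∀ {m} → Fin m → (k : Fin m → Carrier) → ∃[ i ] (∀ j → k i ≤ k j)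
  minimum-Fin i k = let j , _ , least = minimum′ in j , λ l → least (∈-allFin l)
    where
    minimum′ = minimum k (∈-allFin i)

  -- M is the maximum of the numbers b k / a k + 1, where the 1 makes the comparison strict. The
  -- argument of type `Fin m` makes the family nonempty.
  dominate : ∀ {m} → Fin m → (a b : Fin m → Carrier) → (∀ k → 0# ≤ a k) →
             ∃[ M ] (∀ k → ¬ a k ≈ 0# → ¬ M * a k ≤ b k)
  dominate i a b 0≤a = - bound j , strict
    where
    bound : Fin _ → Carrier
    bound k = - (inv (a k) * b k + 1#)

    j = proj₁ (minimum-Fin i bound)

    strict : ∀ k → ¬ a k ≈ 0# → ¬ - bound j * a k ≤ b k
    strict k ak≉0 Ma≤b = ak≉0 (x+y≈0⇒x≈0 (0≤a k) rest (begin
      a k + ((b k - M * a k) + (- bound j - (inv (a k) * b k + 1#)) * a k)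
        ≈⟨ solve 4 (λ a b m i → a :+ ((b :- m :* a) :+ (m :- (i :* b :+ con (ℤ.+ 1))) :* a) := b :- (a :* i) :* b)
             refl (a k) (b k) M (inv (a k)) ⟩
      b k - a k * inv (a k) * b k
        ≈⟨ +-congˡ (-‿cong (trans (*-congʳ (*-inverseʳ ak≉0)) (*-identityˡ (b k)))) ⟩
      b k - b k ≈⟨ -‿inverseʳ (b k) ⟩
      0# ∎))
      where
      M = - bound j

      rest : 0# ≤ (b k - M * a k) + (M - (inv (a k) * b k + 1#)) * a k
      rest = +-nonNegative (x≤y⇒0≤y-x Ma≤b) (*-nonNegative
        (≤-respʳ-≈ (solve 2 (λ x y → (:- x) :- y := :- y :- x) refl (inv (a k) * b k + 1#) (bound j))
          (x≤y⇒0≤y-x (proj₂ (minimum-Fin i bound) k))) (0≤a k))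

  negate : ∀ {n} → Point n → Point n
  negate a i = - a i

  negate-· : ∀ {n} (a x : Point n) → negate a · x ≈ - (a · x)
  negate-· a x = trans
    (sum-cong-≋ λ i → solve 2 (λ a x → (:- a) :* x := (:- con (ℤ.+ 1)) :* (a :* x)) refl (a i) (x i))
    (trans (sym (*-distribˡ-sum (- 1#) (λ i → a i * x i)))
      (solve 1 (λ t → (:- con (ℤ.+ 1)) :* t := :- t) refl (a · x)))

  -- A valid inequality a · x ≤ β becomes a functional that is nonnegative on P and vanishes on the
  -- face it defines.
  slack : ∀ {n} → Point n → Carrier → Point (suc n)
  slack a β = β ∷ᵛ negate a

  slack-∙ : ∀ {n} (a : Point n) β x → slack a β ∙ x ≈ β - a · x
  slack-∙ a β x = +-cong (*-identityʳ β) (negate-· a x)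

  linear-∙ : ∀ {n} a (y : Point (suc n)) b z (x : Point n) → linear a y b z ∙ x ≈ a * y ∙ x + b * z ∙ x
  linear-∙ a y b z x = linear-· a y b z (homogenise x)

  difference-· : ∀ {n} (a x q : Point n) → a · (λ i → x i - q i) ≈ a · x - a · q
  difference-· a x q = begin
    sum (λ i → a i * (x i - q i))
      ≈⟨ sum-cong-≋ (λ i → solve 3 (λ a x q → a :* (x :- q) := a :* x :+ (:- a) :* q) refl (a i) (x i) (q i)) ⟩
    sum (λ i → a i * x i + - a i * q i)     ≈⟨ ∑-distrib-+ (λ i → a i * x i) (λ i → - a i * q i) ⟩
    a · x + negate a · q                    ≈⟨ +-congˡ (negate-· a q) ⟩
    a · x - a · q                           ∎

  distance² : ∀ {n} → Point n → Point n → Carrier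
  distance² x q = (λ i → x i - q i) · (λ i → x i - q i)

  -- If |x| ≤ |q|, this formula forces q · x ≤ q · q, with equality only for x = q. That is why a
  -- point farthest from the origin is exposed.
  distance²-expand : ∀ {n} (x q : Point n) → distance² x q ≈ x · x - q · q - (q · x - q · q) - (q · x - q · q)
  distance²-expand x q = begin
    d · d                                   ≈⟨ difference-· d x q ⟩
    d · x - d · q                           ≈⟨ +-cong (·-comm d x) (-‿cong (·-comm d q)) ⟩
    x · d - q · d                           ≈⟨ +-cong (difference-· x x q) (-‿cong (difference-· q x q)) ⟩
    (x · x - x · q) - (q · x - q · q)       ≈⟨ +-congʳ (+-congˡ (-‿cong (·-comm x q))) ⟩
    (x · x - q · x) - (q · x - q · q)
      ≈⟨ solve 3 (λ xx qx qq → (xx :- qx) :- (qx :- qq) := xx :- qq :- (qx :- qq) :- (qx :- qq)) refl (x · x) (q · x) (q · q) ⟩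
    x · x - q · q - (q · x - q · q) - (q · x - q · q) ∎
    where
    d : Point _
    d i = x i - q i

  distance²≈0⇒≋ : ∀ {n} (x q : Point n) → distance² x q ≈ 0# → x ≋ q
  distance²≈0⇒≋ x q d≈0 i = begin
    x i               ≈⟨ solve 2 (λ x q → x := (x :- q) :+ q) refl (x i) (q i) ⟩
    (x i - q i) + q i ≈⟨ +-congʳ (decidable-stable ((x i - q i) ≟ 0#) λ ≉0 → *-nonZero ≉0 ≉0
                           (sum≈0⇒≈0 (λ i → square-nonNegative (x i - q i)) d≈0 i)) ⟩
    0# + q i          ≈⟨ +-identityˡ (q i) ⟩
    q i               ∎

  distance²-nonNegative : ∀ {n} (x q : Point n) → 0# ≤ distance² x q
  distance²-nonNegative x q = sum-nonNegative λ i → square-nonNegative (x i - q i)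

  0≤x+x⇒0≤x : ∀ {x} → 0# ≤ x + x → 0# ≤ x
  0≤x+x⇒0≤x {x} 0≤x+x with ≤-total 0# x
  ... | inj₁ 0≤x = 0≤x
  ... | inj₂ x≤0 = ≤-respʳ-≈ (solve 1 (λ x → (x :+ x) :+ (:- x) := x) refl x)
    (+-nonNegative 0≤x+x (x≤0⇒0≤-x x≤0))

  -- Vertices among the generators of a polytope

  module Generated {n m} {P : Subset n} (p : Vector (Point n) m) (P≐hull : P ≐ convexHull p) where

    generator∈P : ∀ k → P (p k)
    generator∈P k = proj₂ P≐hull (unit k , unit-nonNegative k , vertex∈affineSpan p k .proj₂)

    P-resp-≋ : ∀ {x x′} → x ≋ x′ → P x → P x′
    P-resp-≋ x≋x′ x∈P with w , 0≤w , ∑w≈1 , wp≋x ← proj₁ P≐hull x∈P =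
      proj₂ P≐hull (w , 0≤w , ∑w≈1 , λ j → trans (wp≋x j) (x≋x′ j))

    nonNegative-on-P : ∀ y → (∀ k → 0# ≤ y ∙ p k) → ∀ x → P x → 0# ≤ y ∙ x
    nonNegative-on-P y 0≤y x x∈P with w , 0≤w , ∑w≈1 , wp≋x ← proj₁ P≐hull x∈P =
      ≤-respʳ-≈ (sym (∙-combination w p ∑w≈1 wp≋x y))
        (sum-nonNegative λ k → *-nonNegative (0≤w k) (0≤y k))

    -- The value at x is a weighted sum of nonnegative values, so it can vanish only if every term
    -- does.
    weights-on-face : ∀ y → (∀ k → 0# ≤ y ∙ p k) → ∀ x → P x → y ∙ x ≈ 0# →
      ∃[ w ] (∀ k → 0# ≤ w k) × sum w ≈ 1# × combination w p ≋ x × (∀ k → w k ≈ 0# ⊎ y ∙ p k ≈ 0#)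
    weights-on-face y 0≤y x x∈P y∙x≈0 with w , 0≤w , ∑w≈1 , wp≋x ← proj₁ P≐hull x∈P =
      w , 0≤w , ∑w≈1 , wp≋x , on-face
      where
      terms≈0 : ∀ k → w k * y ∙ p k ≈ 0#
      terms≈0 = sum≈0⇒≈0 (λ k → *-nonNegative (0≤w k) (0≤y k))
        (trans (sym (∙-combination w p ∑w≈1 wp≋x y)) y∙x≈0)

      on-face : ∀ k → w k ≈ 0# ⊎ y ∙ p k ≈ 0#
      on-face k with w k ≟ 0#
      ... | yes wk≈0 = inj₁ wk≈0
      ... | no wk≉0  = inj₂ (xy≈0⇒y≈0 wk≉0 (terms≈0 k))

    -- Only generators on the face carry weight, and all of these coincide with q, which may be
    -- listed several times in `p`.
    exposed⇒vertex : ∀ a β q → P q → slack a β ∙ q ≈ 0# → (∀ k → 0# ≤ slack a β ∙ p k) →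
                     (∀ k → slack a β ∙ p k ≈ 0# → p k ≋ q) → IsVertex P q
    exposed⇒vertex a β q q∈P q≈0 p≥0 p≈0⇒≋ = a , β ,
      (λ x x∈P → 0≤y-x⇒x≤y (≤-respʳ-≈ (slack-∙ a β x) (nonNegative-on-P (slack a β) p≥0 x x∈P))) ,
      (λ {x} q≋x → P-resp-≋ q≋x q∈P , trans (sym (·-congʳ a q≋x)) a·q≈β) ,
      λ {x} (x∈P , a·x≈β) j →
        let w , 0≤w , ∑w≈1 , wp≋x , on-face = weights-on-face (slack a β) p≥0 x x∈P
              (trans (slack-∙ a β x) (trans (+-congˡ (-‿cong a·x≈β)) (-‿inverseʳ β)))
        in begin
        q j                         ≈⟨ *-identityˡ (q j) ⟨
        1# * q j                    ≈⟨ *-congʳ ∑w≈1 ⟨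
        sum w * q j                 ≈⟨ *-distribʳ-sum (q j) w ⟩
        sum (λ k → w k * q j)       ≈⟨ sum-cong-≋ (λ k → same-term w on-face j k) ⟨
        combination w p j           ≈⟨ wp≋x j ⟩
        x j                         ∎
      where
      a·q≈β : a · q ≈ β
      a·q≈β = begin
        a · q             ≈⟨ solve 2 (λ a b → a := b :- (b :- a)) refl (a · q) β ⟩
        β - (β - a · q)   ≈⟨ +-congˡ (-‿cong (trans (sym (slack-∙ a β q)) q≈0)) ⟩
        β - 0#            ≈⟨ solve 1 (λ b → b :- con (ℤ.+ 0) := b) refl β ⟩
        β                 ∎

      same-term : ∀ w → (∀ k → w k ≈ 0# ⊎ slack a β ∙ p k ≈ 0#) → ∀ j k → w k * p k j ≈ w k * q j
      same-term w on-face j k with on-face k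
      ... | inj₁ wk≈0 = trans (*-congʳ wk≈0) (trans (zeroˡ _) (sym (trans (*-congʳ wk≈0) (zeroˡ _))))
      ... | inj₂ pk≈0 = *-congˡ (p≈0⇒≋ k pk≈0 j)

    -- Among the generators minimising y, one that is farthest from the origin is exposed: its
    -- inner product with the other minimisers is smaller, and a large multiple M
    -- of y takes care of the remaining generators.
    farthest-minimiser-vertex : ∀ y k → (∀ l → y ∙ p k ≤ y ∙ p l) →
      (∀ l → y ∙ p l ≈ y ∙ p k → p l · p l ≤ p k · p k) →
      ∀ M → (∀ l → ¬ y ∙ p l - y ∙ p k ≈ 0# → ¬ M * (y ∙ p l - y ∙ p k) ≤ p k · p l - p k · p k) →
      IsVertex P (p k)
    farthest-minimiser-vertex y k least farthest M large =
      exposed⇒vertex a β q (generator∈P k) q≈0 p≥0 p≈0⇒≋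
      where
      q = p k
      -- The objective is q · x - M (y ∙ x), up to the constant term of y, which cancels in the
      -- slack.
      a = linear 1# q (- M) (tail y)
      β = a · q

      excess : Fin m → Carrier
      excess l = y ∙ p l - y ∙ q

      slack-at : ∀ l → slack a β ∙ p l ≈ M * excess l - (q · p l - q · q)
      slack-at l = begin
        slack a β ∙ p l         ≈⟨ slack-∙ a β (p l) ⟩
        a · q - a · p l         ≈⟨ +-cong (linear-· 1# q (- M) (tail y) q) (-‿cong (linear-· 1# q (- M) (tail y) (p l))) ⟩
        (1# * (q · q) + - M * (tail y · q)) - (1# * (q · p l) + - M * (tail y · p l))
          ≈⟨ solve 5 (λ M t s qq qp → (con (ℤ.+ 1) :* qq :+ (:- M) :* t) :- (con (ℤ.+ 1) :* qp :+ (:- M) :* s) :=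
                       M :* (s :- t) :- (qp :- qq)) refl M (tail y · q) (tail y · p l) (q · q) (q · p l) ⟩
        M * (tail y · p l - tail y · q) - (q · p l - q · q)
          ≈⟨ +-congʳ (*-congˡ (solve 3 (λ h s t → s :- t := (h :+ s) :- (h :+ t)) refl
               (y zero * 1#) (tail y · p l) (tail y · q))) ⟩
        M * excess l - (q · p l - q · q) ∎

      minimiser : ∀ l → excess l ≈ 0# →
                  slack a β ∙ p l + slack a β ∙ p l ≈ distance² (p l) q + (q · q - p l · p l)
      minimiser l excess≈0 = begin
        slack a β ∙ p l + slack a β ∙ p l
          ≈⟨ +-cong slack≈ slack≈ ⟩
        - (q · p l - q · q) + - (q · p l - q · q)
          ≈⟨ solve 3 (λ pp qp qq → (:- (qp :- qq)) :+ (:- (qp :- qq)) :=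
                       (pp :- qq :- (qp :- qq) :- (qp :- qq)) :+ (qq :- pp)) refl (p l · p l) (q · p l) (q · q) ⟩
        (p l · p l - q · q - (q · p l - q · q) - (q · p l - q · q)) + (q · q - p l · p l)
          ≈⟨ +-congʳ (distance²-expand (p l) q) ⟨
        distance² (p l) q + (q · q - p l · p l) ∎
        where
        slack≈ : slack a β ∙ p l ≈ - (q · p l - q · q)
        slack≈ = trans (slack-at l) (trans (+-congʳ (*-congˡ excess≈0))
          (solve 2 (λ M t → M :* con (ℤ.+ 0) :- t := :- t) refl M (q · p l - q · q)))

      farther : ∀ l → excess l ≈ 0# → 0# ≤ q · q - p l · p l
      farther l excess≈0 = x≤y⇒0≤y-x (farthest l (trans
        (solve 2 (λ s t → s := (s :- t) :+ t) refl (y ∙ p l) (y ∙ q)) (trans (+-congʳ excess≈0) (+-identityˡ _))))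

      q≈0 : slack a β ∙ q ≈ 0#
      q≈0 = trans (slack-∙ a β q) (-‿inverseʳ β)

      strict : ∀ l → ¬ excess l ≈ 0# → ¬ slack a β ∙ p l ≤ 0#
      strict l ≉0 ≤0 = large l ≉0 (0≤y-x⇒x≤y (≤-respʳ-≈
        (trans (-‿cong (slack-at l)) (solve 2 (λ s t → :- (s :- t) := t :- s) refl (M * excess l) (q · p l - q · q)))
        (x≤0⇒0≤-x ≤0)))

      p≥0 : ∀ l → 0# ≤ slack a β ∙ p l
      p≥0 l with excess l ≟ 0#
      ... | yes ≈0 = 0≤x+x⇒0≤x (≤-respʳ-≈ (sym (minimiser l ≈0))
        (+-nonNegative (distance²-nonNegative (p l) q) (farther l ≈0)))
      ... | no ≉0 with ≤-total 0# (slack a β ∙ p l)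
      ...   | inj₁ 0≤ = 0≤
      ...   | inj₂ ≤0 = contradiction ≤0 (strict l ≉0)

      p≈0⇒≋ : ∀ l → slack a β ∙ p l ≈ 0# → p l ≋ q
      p≈0⇒≋ l slack≈0 with excess l ≟ 0#
      ... | yes ≈0 = distance²≈0⇒≋ (p l) q (x+y≈0⇒x≈0 (distance²-nonNegative (p l) q) (farther l ≈0)
        (trans (sym (minimiser l ≈0)) (trans (+-cong slack≈0 slack≈0) (+-identityˡ 0#))))
      ... | no ≉0  = contradiction (≤-reflexive slack≈0) (strict l ≉0)

    -- Minimisers of y need not be vertices; distance from the origin breaks the tie.
    minimal-vertex : Fin m → ∀ y → ∃[ k ] IsVertex P (p k) × (∀ l → y ∙ p k ≤ y ∙ p l)
    minimal-vertex k₀ y =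
      k , farthest-minimiser-vertex y k least farthest (proj₁ M) (proj₂ M) , least
      where
      k₁ = minimum-Fin k₀ (λ k → y ∙ p k)

      k₂ = minimum (λ k → - (p k · p k))
             (∈-filter⁺ (λ k → y ∙ p k ≟ y ∙ p (proj₁ k₁)) (∈-allFin (proj₁ k₁)) refl)

      k = proj₁ k₂

      yk≈yk₁ : y ∙ p k ≈ y ∙ p (proj₁ k₁)
      yk≈yk₁ = proj₂ (∈-filter⁻ (λ k → y ∙ p k ≟ y ∙ p (proj₁ k₁)) {xs = allFin m} (proj₁ (proj₂ k₂)))

      least : ∀ l → y ∙ p k ≤ y ∙ p l
      least l = ≤-respˡ-≈ (sym yk≈yk₁) (proj₂ k₁ l)

      farthest : ∀ l → y ∙ p l ≈ y ∙ p k → p l · p l ≤ p k · p k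
      farthest l yl≈yk = 0≤y-x⇒x≤y (≤-respʳ-≈
        (solve 2 (λ a b → (:- a) :- (:- b) := b :- a) refl (p l · p l) (p k · p k))
        (x≤y⇒0≤y-x (proj₂ (proj₂ k₂) (∈-filter⁺ (λ k → y ∙ p k ≟ y ∙ p (proj₁ k₁)) (∈-allFin l)
          (trans yl≈yk yk≈yk₁)))))

      M : ∃[ M ] (∀ l → ¬ y ∙ p l - y ∙ p k ≈ 0# → ¬ M * (y ∙ p l - y ∙ p k) ≤ p k · p l - p k · p k)
      M = dominate k₀ (λ l → y ∙ p l - y ∙ p k) (λ l → p k · p l - p k · p k) (λ l → x≤y⇒0≤y-x (least l))

    -- The functional M g + h coincides with h on the face g = 0, so it is enough that its least
    -- value, attained at a vertex, is nonnegative.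
    nonNegative-at-generator : ∀ g h → (∀ k → 0# ≤ g ∙ p k) →
      (∀ q → IsVertex P q → g ∙ q ≈ 0# → 0# ≤ h ∙ q) → ∀ k → g ∙ p k ≈ 0# → 0# ≤ h ∙ p k
    nonNegative-at-generator g h g≥0 h≥0 k₀ gk₀≈0 =
      ≤-trans 0≤yk (≤-respʳ-≈ (y≈h k₀ gk₀≈0) (proj₂ (proj₂ minimal) k₀))
      where
      -- The weight M forces the minimiser of y onto the face unless y is nonnegative there.
      M,large : ∃[ M ] (∀ k → ¬ g ∙ p k ≈ 0# → ¬ M * g ∙ p k ≤ - (h ∙ p k))
      M,large = dominate k₀ (λ k → g ∙ p k) (λ k → - (h ∙ p k)) g≥0

      M = proj₁ M,large
      y = linear M g 1# h

      minimal : ∃[ k ] IsVertex P (p k) × (∀ l → y ∙ p k ≤ y ∙ p l)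
      minimal = minimal-vertex k₀ y

      k = proj₁ minimal

      y≈h : ∀ k → g ∙ p k ≈ 0# → y ∙ p k ≈ h ∙ p k
      y≈h k gk≈0 = trans (linear-∙ M g 1# h (p k)) (trans (+-congʳ (*-congˡ gk≈0))
        (solve 2 (λ M h → M :* con (ℤ.+ 0) :+ con (ℤ.+ 1) :* h := h) refl M (h ∙ p k)))

      off-face : ¬ g ∙ p k ≈ 0# → M * g ∙ p k ≤ - (h ∙ p k) ⊎ - (h ∙ p k) ≤ M * g ∙ p k → 0# ≤ y ∙ p k
      off-face gk≉0 (inj₁ ≤-h) = contradiction ≤-h (proj₂ M,large k gk≉0)
      off-face gk≉0 (inj₂ -h≤) = ≤-respʳ-≈ (trans
        (solve 2 (λ s h → s :- (:- h) := s :+ con (ℤ.+ 1) :* h) refl (M * g ∙ p k) (h ∙ p k))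
        (sym (linear-∙ M g 1# h (p k)))) (x≤y⇒0≤y-x -h≤)

      by-cases : Dec (g ∙ p k ≈ 0#) → 0# ≤ y ∙ p k
      by-cases (yes gk≈0) = ≤-respʳ-≈ (sym (y≈h k gk≈0)) (h≥0 (p k) (proj₁ (proj₂ minimal)) gk≈0)
      by-cases (no gk≉0)  = off-face gk≉0 (≤-total (M * g ∙ p k) (- (h ∙ p k)))

      0≤yk : 0# ≤ y ∙ p k
      0≤yk = by-cases (g ∙ p k ≟ 0#)

    -- The dual form of the fact that a face is the convex hull of the vertices on it.
    nonNegative-on-face : ∀ g h → (∀ k → 0# ≤ g ∙ p k) →
      (∀ q → IsVertex P q → g ∙ q ≈ 0# → 0# ≤ h ∙ q) → ∀ x → P x → g ∙ x ≈ 0# → 0# ≤ h ∙ x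
    nonNegative-on-face g h g≥0 h≥0 x x∈P g∙x≈0
      with w , 0≤w , ∑w≈1 , wp≋x , on-face ← weights-on-face g g≥0 x x∈P g∙x≈0
      = ≤-respʳ-≈ (sym (∙-combination w p ∑w≈1 wp≋x h)) (sum-nonNegative λ k → term≥0 k (on-face k))
      where
      term≥0 : ∀ k → w k ≈ 0# ⊎ g ∙ p k ≈ 0# → 0# ≤ w k * h ∙ p k
      term≥0 k (inj₁ wk≈0) = ≤-reflexive (sym (trans (*-congʳ wk≈0) (zeroˡ _)))
      term≥0 k (inj₂ gk≈0) = *-nonNegative (0≤w k) (nonNegative-at-generator g h g≥0 h≥0 k gk≈0)

-- The vertex set of a full-dimensional polytope

module TwoLevelPolytope {c ℓ₁ ℓ₂} (ℝ : RealField c ℓ₁ ℓ₂)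
  {d-1 : ℕ} {P : Polytopes.Subset ℝ (suc d-1)}
  (isPolytope : Polytopes.IsPolytope ℝ P) (hasDimension : Polytopes.HasDimension ℝ P (suc d-1))
  {f₀ : ℕ} (vertices : Polytopes.HasCardinality ℝ (Polytopes.Vertices ℝ P) f₀) where

  open RealField ℝ hiding (zero)
  open Polytopes ℝ
  open OrderedField ℝ
  open LinearAlgebra ℝ
  open Polytope ℝ
  open Solver using (solve; _:=_; _:+_; _:*_; _:-_; :-_; con)
  open SemiringSum semiring using (sum; sum-cong-≋; *-distribˡ-sum)
  open VectorEquality (RealField.setoid ℝ) using (_≋_)
  open import Relation.Binary.Reasoning.Setoid (RealField.setoid ℝ)
  open Generated (proj₁ (proj₂ isPolytope)) (proj₂ (proj₂ isPolytope))

  private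
    d = suc d-1

  v : Fin f₀ → Point d
  v s = proj₁ (Bijection.to vertices s)

  v-vertex : ∀ s → IsVertex P (v s)
  v-vertex s = proj₂ (Bijection.to vertices s)

  v-surjective : ∀ q → IsVertex P q → ∃[ s ] v s ≋ q
  v-surjective q q-vertex = Bijection.strictlySurjective vertices (q , q-vertex)

  v-injective : ∀ {s t} → v s ≋ v t → s ≡ t
  v-injective = Bijection.injective vertices

  v∈P : ∀ s → P (v s)
  v∈P s = let _ , _ , _ , v≐ = v-vertex s in proj₁ (proj₁ v≐ (λ _ → refl))

  open Functionals ℝ (homogenise ∘ v) one (λ s → one≈1 (v s))
  open Counting ℝ (homogenise ∘ v) one (λ s → one≈1 (v s))

  S : List (Fin f₀)
  S = allFin f₀

  NonNegativeOn : Subset d → Point (suc d) → Set _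
  NonNegativeOn F y = ∀ x → F x → 0# ≤ y ∙ x

  face-nonNegative : ∀ g h → NonNegativeOn P g → (∀ s → g at s ≈ 0# → 0# ≤ h at s) →
                     ∀ x → P x → g ∙ x ≈ 0# → 0# ≤ h ∙ x
  face-nonNegative g h g≥0 h≥0 = nonNegative-on-face g h (λ k → g≥0 _ (generator∈P k)) λ q q-vertex g∙q≈0 →
    let s , vs≋q = v-surjective q q-vertex in
    ≤-respʳ-≈ (·-congʳ h (homogenise-cong vs≋q))
      (h≥0 s (trans (·-congʳ g (homogenise-cong vs≋q)) g∙q≈0))

  face-vanishes : ∀ g h → NonNegativeOn P g → (∀ s → g at s ≈ 0# → h at s ≈ 0#) →
                  ∀ x → P x → g ∙ x ≈ 0# → h ∙ x ≈ 0#
  face-vanishes g h g≥0 h≈0 x x∈P g∙x≈0 = ≤-antisym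
    (0≤-x⇒x≤0 (≤-respʳ-≈ (negate-· h (homogenise x))
      (face-nonNegative g (negate h) g≥0
        (λ s gs≈0 → ≤-reflexive (sym (trans (negate-· h (homogenise (v s)))
          (trans (-‿cong (h≈0 s gs≈0)) (solve 0 (:- con (ℤ.+ 0) := con (ℤ.+ 0)) refl)))))
        x x∈P g∙x≈0)))
    (face-nonNegative g h g≥0 (λ s gs≈0 → ≤-reflexive (sym (h≈0 s gs≈0))) x x∈P g∙x≈0)

  -- P is the face cut out by the zero functional, so statements about faces also cover P.
  zero≥0 : NonNegativeOn P 0ᵛ
  zero≥0 x _ = ≤-reflexive (sym (·-zeroˡ (homogenise x)))

  nonNegative-at⇒on : ∀ y → (∀ s → 0# ≤ y at s) → NonNegativeOn P y
  nonNegative-at⇒on y y≥0 x x∈P =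
    face-nonNegative 0ᵛ y zero≥0 (λ s _ → y≥0 s) x x∈P (·-zeroˡ (homogenise x))

  vanishes-at⇒on : ∀ y → (∀ s → y at s ≈ 0#) → ∀ x → P x → y ∙ x ≈ 0#
  vanishes-at⇒on y y≈0 x x∈P =
    face-vanishes 0ᵛ y zero≥0 (λ s _ → y≈0 s) x x∈P (·-zeroˡ (homogenise x))

  -- If the face had no vertex, `one` would vacuously vanish at all its vertices and hence on the
  -- face, giving 1 = 0 at x.
  face-has-vertex : ∀ y → NonNegativeOn P y → ∀ x → P x → y ∙ x ≈ 0# → ∃[ s ] y at s ≈ 0#
  face-has-vertex y y≥0 x x∈P y∙x≈0 with any? (λ s → y at s ≟ 0#)
  ... | yes found = found
  ... | no none   = contradiction (trans (sym (one≈1 x))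
    (face-vanishes y one y≥0 (λ s ys≈0 → contradiction (s , ys≈0) none) x x∈P y∙x≈0)) 1≉0

  -- P has the dimension of the ambient space, so its affine hull contains d + 1 points whose
  -- homogenisations form a basis of ℝᵈ⁺¹.
  vanishes⇒zero : ∀ y → (∀ s → y at s ≈ 0#) → ∀ j → y j ≈ 0#
  vanishes⇒zero y y≈0 = annihilator-trivial {B = homogenise ∘ b}
    (affinelyIndependent⇒independent {b = b} b-independent) y λ i →
      vanishes-on-affineHull {F = P} y (vanishes-at⇒on y y≈0) (b i)
        (proj₂ hull≐span (vertex∈affineSpan b i))
    where
    b             = proj₁ hasDimension
    b-independent = proj₁ (proj₂ hasDimension)
    hull≐span     = proj₂ (proj₂ hasDimension)

  -- From facets of the polytope to facet functionals

  module GivenFacet (F : Subset d) (isFacet : IsFacet d P F) where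

    private
      a    = proj₁ (proj₁ isFacet)
      β    = proj₁ (proj₂ (proj₁ isFacet))
      F≐   = proj₂ (proj₂ (proj₂ (proj₁ isFacet)))
      F-hasDimension = proj₂ isFacet
      b             = proj₁ F-hasDimension
      b-independent = proj₁ (proj₂ F-hasDimension)
      hull≐span     = proj₂ (proj₂ F-hasDimension)

    y : Point (suc d)
    y = slack a β

    y≥0 : NonNegativeOn P y
    y≥0 x x∈P = ≤-respʳ-≈ (sym (slack-∙ a β x)) (x≤y⇒0≤y-x (proj₁ (proj₂ (proj₂ (proj₁ isFacet))) x x∈P))

    F⇒ : ∀ {x} → F x → P x × y ∙ x ≈ 0#
    F⇒ {x} x∈F = let x∈P , a·x≈β = proj₁ F≐ x∈F in
      x∈P , trans (slack-∙ a β x) (x≈y⇒x-y≈0 (sym a·x≈β))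

    ⇒F : ∀ {x} → P x → y ∙ x ≈ 0# → F x
    ⇒F {x} x∈P y∙x≈0 = proj₂ F≐ (x∈P , sym (x-y≈0⇒x≈y (trans (sym (slack-∙ a β x)) y∙x≈0)))

    zero-vertex : ∃[ s ] y at s ≈ 0#
    zero-vertex = let x , x∈F = hasDimension⇒nonempty {F = F} F-hasDimension ; x∈P , y∙x≈0 = F⇒ x∈F in
      face-has-vertex y y≥0 x x∈P y∙x≈0

    vanishes-on-basis : ∀ z → (∀ x → F x → z ∙ x ≈ 0#) → ∀ i → z ∙ b i ≈ 0#
    vanishes-on-basis z z≈0 i =
      vanishes-on-affineHull {F = F} z z≈0 (b i) (proj₂ hull≐span (vertex∈affineSpan b i))

    -- Otherwise every vertex lies on `F`, whose affine hull is spanned by d points. Those d points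
    -- have a nonzero common annihilator in ℝᵈ⁺¹, and it would vanish at all vertices of P.
    nonzero-vertex : ∃[ s ] ¬ y at s ≈ 0#
    nonzero-vertex with any? (λ s → ¬? (y at s ≟ 0#))
    ... | yes found = found
    ... | no none with w , (i , wi≉0) , bw≈0 ← kernel ℕ.≤-refl (homogenise ∘ b) =
      contradiction (vanishes⇒zero w (λ s → w≈0 (v s) (⇒F (v∈P s)
        (decidable-stable (y at s ≟ 0#) λ ≉0 → none (s , ≉0)))) i) wi≉0
      where
      w≈0 : ∀ x → F x → w ∙ x ≈ 0#
      w≈0 x x∈F = vanishes-on-affineSpan {b = b} w
        (λ i → trans (·-comm w (homogenise (b i))) (bw≈0 i)) x
        (proj₁ hull≐span (1 , (λ _ → x) , (λ _ → x∈F) , vertex∈affineSpan (λ (_ : Fin 1) → x) zero))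

    -- The combination h of z and y that vanishes at s₁ also vanishes on an affine basis of the
    -- facet. Together these points form a basis of ℝᵈ⁺¹, so h is zero.
    multiples : ∀ z → (∀ s → y at s ≈ 0# → z at s ≈ 0#) → ∃[ μ ] (∀ s → z at s ≈ μ * y at s)
    multiples z z≈0 = z at s₁ * inv (y at s₁) , λ s → *-cancelˡ ys₁≉0 (begin
      y at s₁ * z at s                                ≈⟨ x-y≈0⇒x≈y (trans (sym (h-at s))
                                                           (trans (·-congˡ (homogenise (v s)) h≈0) (·-zeroˡ (homogenise (v s))))) ⟩
      z at s₁ * y at s                                ≈⟨ *-identityˡ _ ⟨
      1# * (z at s₁ * y at s)                         ≈⟨ *-congʳ (*-inverseʳ ys₁≉0) ⟨
      y at s₁ * inv (y at s₁) * (z at s₁ * y at s)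
        ≈⟨ solve 4 (λ a b c d → a :* b :* (c :* d) := a :* (c :* b :* d)) refl (y at s₁) (inv (y at s₁)) (z at s₁) (y at s) ⟩
      y at s₁ * (z at s₁ * inv (y at s₁) * y at s)    ∎)
      where
      s₁    = proj₁ nonzero-vertex
      ys₁≉0 = proj₂ nonzero-vertex
      h     = linear (y at s₁) z (- (z at s₁)) y

      h-∙ : ∀ x → h ∙ x ≈ y at s₁ * z ∙ x - z at s₁ * y ∙ x
      h-∙ x = trans (linear-∙ (y at s₁) z (- (z at s₁)) y x)
        (solve 3 (λ a b c → a :+ (:- b) :* c := a :- b :* c) refl (y at s₁ * z ∙ x) (z at s₁) (y ∙ x))

      h-at : ∀ s → h at s ≈ y at s₁ * z at s - z at s₁ * y at s
      h-at s = h-∙ (v s)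

      B : Fin (suc d) → Point d
      B = v s₁ ∷ᵛ b

      B-independent : Independent (homogenise ∘ B)
      B-independent w wB≈0 = λ { zero → w₀≈0 ; (suc i) → w≈0 i }
        where
        w₀≈0 : w zero ≈ 0#
        w₀≈0 = xy≈0⇒y≈0 ys₁≉0 (begin
          y at s₁ * w zero                              ≈⟨ *-comm _ _ ⟩
          w zero * y at s₁                              ≈⟨ +-identityʳ _ ⟨
          w zero * y at s₁ + 0#                         ≈⟨ +-congˡ (sum-zero λ i → trans (*-congˡ
                                                             (vanishes-on-basis y (λ x x∈F → proj₂ (F⇒ x∈F)) i)) (zeroʳ (w (suc i)))) ⟨
          sum (λ i → w i * y ∙ B i)                     ≈⟨ ·-combination y w (homogenise ∘ B) ⟨
          y · combination w (homogenise ∘ B)            ≈⟨ ·-zeroʳ y wB≈0 ⟩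
          0#                                            ∎)

        w≈0 : ∀ i → w (suc i) ≈ 0#
        w≈0 = affinelyIndependent⇒independent {b = b} b-independent (tail w) λ j → begin
          combination (tail w) (homogenise ∘ b) j       ≈⟨ +-identityˡ _ ⟨
          0# + combination (tail w) (homogenise ∘ b) j  ≈⟨ +-congʳ (trans (*-congʳ w₀≈0) (zeroˡ _)) ⟨
          combination w (homogenise ∘ B) j              ≈⟨ wB≈0 j ⟩
          0#                                            ∎

      h≈0 : h ≋ 0ᵛ
      h≈0 = annihilator-trivial {B = homogenise ∘ B} B-independent h
        λ { zero → trans (h-at s₁) (solve 2 (λ a b → a :* b :- b :* a := con (ℤ.+ 0)) refl (y at s₁) (z at s₁))
          ; (suc i) → trans (h-∙ (b i)) (trans
              (+-cong (*-congˡ (vanishes-on-basis z z-on-F i))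
                (-‿cong (*-congˡ (vanishes-on-basis y (λ x x∈F → proj₂ (F⇒ x∈F)) i))))
              (solve 2 (λ a b → a :* con (ℤ.+ 0) :- b :* con (ℤ.+ 0) := con (ℤ.+ 0)) refl (y at s₁) (z at s₁))) }
        where
        z-on-F : ∀ x → F x → z ∙ x ≈ 0#
        z-on-F x x∈F = let x∈P , y∙x≈0 = F⇒ x∈F in face-vanishes y z y≥0 z≈0 x x∈P y∙x≈0

    facet : Facet S y
    facet = record
      { nonNegative = λ {s} _ → y≥0 (v s) (v∈P s)
      ; nonZero     = proj₁ nonzero-vertex , ∈-allFin _ , proj₂ nonzero-vertex
      ; multiples   = λ z z≈0 → let μ , z≈μy = multiples z (λ s → z≈0 (∈-allFin s)) in μ , λ {s} _ → z≈μy s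
      }

  -- From facet functionals to facet-defining hyperplanes

  module _ {y : Point (suc d)} (Y : Facet S y) where

    private
      a : Point d
      a = negate (tail y)

      β : Carrier
      β = y zero

      y-∙ : ∀ x → y ∙ x ≈ β - a · x
      y-∙ x = trans (·-congˡ {y = y} {slack a β} (homogenise x) λ { zero → refl ; (suc j) → solve 1 (λ t → t := :- (:- t)) refl (y (suc j)) })
        (slack-∙ a β x)

      y≥0 : NonNegativeOn P y
      y≥0 = nonNegative-at⇒on y λ s → Facet.nonNegative Y (∈-allFin s)

      s₁    = proj₁ (Facet.nonZero Y)
      ys₁≉0 = proj₂ (proj₂ (Facet.nonZero Y))

      on-face : ∀ x → a · x ≈ β → y ∙ x ≈ 0#
      on-face x a·x≈β = trans (y-∙ x) (x≈y⇒x-y≈0 (sym a·x≈β))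

      face-on : ∀ x → y ∙ x ≈ 0# → a · x ≈ β
      face-on x y∙x≈0 = sym (x-y≈0⇒x≈y (trans (sym (y-∙ x)) y∙x≈0))

    multiple-of : ∀ z → (∀ s → y at s ≈ 0# → z at s ≈ 0#) → z at s₁ ≈ 0# → ∀ j → z j ≈ 0#
    multiple-of z z≈0 zs₁≈0 =
      let μ , z≈μy = Facet.multiples Y z (λ {s} _ → z≈0 s) in
      vanishes⇒zero z λ s → begin
        z at s      ≈⟨ z≈μy (∈-allFin s) ⟩
        μ * y at s  ≈⟨ *-congʳ (xy≈0⇒y≈0 ys₁≉0 (trans (*-comm _ μ) (trans (sym (z≈μy (∈-allFin s₁))) zs₁≈0))) ⟩
        0# * y at s ≈⟨ zeroˡ _ ⟩
        0#          ∎

    -- If a = 0 then y is constant on P and vanishes nowhere, so that every functional is a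
    -- multiple of y on the vertices.
    normal≉0 : ¬ a ≋ 0ᵛ
    normal≉0 a≈0 = ys₁≉0 (begin
      y at s₁                 ≈⟨ y-const s₁ ⟩
      β                       ≈⟨ z₁≈β ⟨
      z (suc zero)            ≈⟨ multiple-of z (λ s ys≈0 → contradiction
                                   (trans (trans (y-const s₁) (sym (y-const s))) ys≈0) ys₁≉0) zs₁≈0 (suc zero) ⟩
      0#                      ∎)
      where
      y-const : ∀ s → y at s ≈ β
      y-const s = trans (y-∙ (v s)) (trans
        (+-congˡ (-‿cong (trans (·-congˡ (v s) a≈0) (·-zeroˡ (v s)))))
        (solve 1 (λ b → b :- con (ℤ.+ 0) := b) refl β))

      -- A coordinate functional, which exists because d ≥ 1. Corrected by y it vanishes at s₁ but
      -- keeps the coefficient β, since the linear part of y is zero.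
      e : Point (suc d)
      e = unit (suc zero)

      z : Point (suc d)
      z = linear β e (- (e at s₁)) y

      zs₁≈0 : z at s₁ ≈ 0#
      zs₁≈0 = trans (linear-at β e (- (e at s₁)) y s₁) (trans
        (+-congˡ (*-congˡ (y-const s₁)))
        (solve 2 (λ b t → b :* t :+ (:- t) :* b := con (ℤ.+ 0)) refl β (e at s₁)))

      z₁≈β : z (suc zero) ≈ β
      z₁≈β = trans (+-congˡ (*-congˡ (trans (solve 1 (λ t → t := :- (:- t)) refl (y (suc zero)))
        (trans (-‿cong (a≈0 zero)) (solve 0 (:- con (ℤ.+ 0) := con (ℤ.+ 0)) refl)))))
        (solve 2 (λ b t → b :* con (ℤ.+ 1) :+ (:- t) :* con (ℤ.+ 0) := b) refl β (e at s₁))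

    hyperplane : Hyperplane d
    hyperplane = record { normal = a ; offset = β ; nonzero = normal≉0 }

    private
      F : Subset d
      F = P ∩ ⟦ hyperplane ⟧

      Z : List (Fin f₀)
      Z = filter (λ s → y at s ≟ 0#) S

      Z⁻ : ∀ {s} → s ∈ Z → y at s ≈ 0#
      Z⁻ s∈ = proj₂ (∈-filter⁻ (λ s → y at s ≟ 0#) {xs = S} s∈)

      Systems : ℕ → Set (c ⊔ ℓ₁)
      Systems k = Σ[ xs ∈ Vector (Fin f₀) k ] Triangular xs × (∀ i → xs i ∈ Z)

    -- By maximality the system and the vertex s₁ off the face span the whole space, so the
    -- system has exactly d members.
    maximal-system⇒hasDimension : ∀ k → Systems k → (∀ j → Systems j → j ℕ.≤ k) → HasDimension F d-1
    maximal-system⇒hasDimension k (xs , tri , xs∈Z) max = conclude k≡d xs tri xs∈Z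
      where
      vanishes-on-Z : ∀ z → (∀ i → z at xs i ≈ 0#) → ∀ s → y at s ≈ 0# → z at s ≈ 0#
      vanishes-on-Z z z≈0 s ys≈0 = decidable-stable (z at s ≟ 0#) λ zs≉0 →
        ℕ.1+n≰n (max (suc k) (s ∷ᵛ xs , ((z , zs≉0 , z≈0) , tri) ,
          λ { zero → ∈-filter⁺ (λ s → y at s ≟ 0#) (∈-allFin s) ys≈0 ; (suc i) → xs∈Z i }))

      tri⁺ : ∀ {k} (xs : Vector (Fin f₀) k) → Triangular xs → (∀ i → xs i ∈ Z) → Triangular (s₁ ∷ᵛ xs)
      tri⁺ xs tri xs∈Z = (y , ys₁≉0 , λ i → Z⁻ (xs∈Z i)) , tri

      k≤d : k ℕ.≤ d
      k≤d = ℕ.s≤s⁻¹ (rankAtMost-dimension S (s₁ ∷ᵛ xs) (tri⁺ xs tri xs∈Z) (λ i → ∈-allFin _))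

      k≮d : ¬ k ℕ.< d
      k≮d k<d = nonzero-annihilator (kernel (ℕ.s≤s k<d) (homogenise ∘ v ∘ (s₁ ∷ᵛ xs)))
        where
        nonzero-annihilator :
          ¬ (∃[ w ] (∃[ i ] ¬ w i ≈ 0#) × (∀ i → homogenise (v ((s₁ ∷ᵛ xs) i)) · w ≈ 0#))
        nonzero-annihilator (w , (i , wi≉0) , w≈0) =
          wi≉0 (multiple-of w (vanishes-on-Z w (λ i → trans (·-comm w (homogenise (v (xs i)))) (w≈0 (suc i))))
            (trans (·-comm w (homogenise (v s₁))) (w≈0 zero)) i)

      k≡d : k ≡ d
      k≡d = ℕ.≤-antisym k≤d (ℕ.≮⇒≥ k≮d)

      conclude : ∀ {k} → k ≡ d → (xs : Vector (Fin f₀) k) → Triangular xs → (∀ i → xs i ∈ Z) → HasDimension F d-1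
      conclude ≡.refl xs tri xs∈Z =
        v ∘ xs , independent⇒affinelyIndependent {b = v ∘ xs} (triangular⇒independent xs tri) ,
        (λ {x} → ⊆span x) ,
        λ {x} (w , ∑w≈1 , wb≋x) → d , v ∘ xs , (λ i → v∈P (xs i) , face-on (v (xs i)) (Z⁻ (xs∈Z i))) , w , ∑w≈1 , wb≋x
        where
        ⊆span : ∀ x → affineHull F x → affineSpan (v ∘ xs) x
        ⊆span x x∈hull = restrict (independent⇒spanning {B = B}
          (triangular⇒independent (s₁ ∷ᵛ xs) (tri⁺ xs tri xs∈Z)) (homogenise x))
          where
          B : Fin (suc d) → Point (suc d)
          B = homogenise ∘ v ∘ (s₁ ∷ᵛ xs)

          y∙x≈0 : y ∙ x ≈ 0#
          y∙x≈0 = vanishes-on-affineHull {F = F} y (λ x (_ , a·x≈β) → on-face x a·x≈β) x x∈hull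

          w₀≈0 : ∀ w → combination w B ≋ homogenise x → w zero ≈ 0#
          w₀≈0 w wB≋x = xy≈0⇒y≈0 ys₁≉0 (begin
            y at s₁ * w zero                ≈⟨ *-comm _ _ ⟩
            w zero * y at s₁                ≈⟨ +-identityʳ _ ⟨
            w zero * y at s₁ + 0#           ≈⟨ +-congˡ (sum-zero λ i → trans (*-congˡ (Z⁻ (xs∈Z i))) (zeroʳ (w (suc i)))) ⟨
            sum (λ i → w i * (y · B i))     ≈⟨ ·-combination y w B ⟨
            y · combination w B             ≈⟨ ·-congʳ y wB≋x ⟩
            y ∙ x                           ≈⟨ y∙x≈0 ⟩
            0#                              ∎)

          drop : ∀ w → w zero ≈ 0# → ∀ j → combination (tail w) (tail B) j ≈ combination w B j
          drop w w₀≈0 j = sym (trans (+-congʳ (trans (*-congʳ w₀≈0) (zeroˡ (B zero j)))) (+-identityˡ _))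

          restrict : (∃[ w ] combination w B ≋ homogenise x) → affineSpan (v ∘ xs) x
          restrict (w , wB≋x) = tail w ,
            trans (sum≈sum*1 (tail w)) (trans (drop w (w₀≈0 w wB≋x) zero) (wB≋x zero)) ,
            λ j → trans (drop w (w₀≈0 w wB≋x) (suc j)) (wB≋x (suc j))

    -- The affine basis required by `HasDimension` comes from a triangular system of greatest length
    -- on the face; the search starts from the empty system.
    facetDefining : ¬ ¬ FacetDefining d P hyperplane
    facetDefining none =
      ¬¬-maximum Systems (suc d) (λ k (xs , tri , _) → rankAtMost-dimension S xs tri (λ i → ∈-allFin _))
        0 ([]ᵛ , tt , λ ()) λ (k , system , max) → none
        ( (a , β , (λ x x∈P → 0≤y-x⇒x≤y (≤-respʳ-≈ (y-∙ x) (y≥0 x x∈P))) , id , id)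
        , maximal-system⇒hasDimension k system max)

    -- Vertices off the face lie on the parallel hyperplane, on which τ a is constant. As its normal
    -- is nonzero, τ can be cancelled, so a is constant on these vertices as well.
    two-valued : TwoLevel d P → ∀ {s t} → ¬ y at s ≈ 0# → ¬ y at t ≈ 0# → y at s ≈ y at t
    two-valued twoLevel {s} {t} ys≉0 yt≉0 = decidable-stable (y at s ≟ y at t) λ differ →
      facetDefining λ defining → differ (compare (twoLevel hyperplane defining))
      where
      compare : (∃[ H′ ] Parallel hyperplane H′ × IsVertex P ⊆ (⟦ hyperplane ⟧ ∪ ⟦ H′ ⟧)) → y at s ≈ y at t
      compare (H′ , (τ , n′≋τa) , covers) = begin
        y at s          ≈⟨ y-∙ (v s) ⟩
        β - a · v s     ≈⟨ +-congˡ (-‿cong (*-cancelˡ τ≉0 (trans (second s ys≉0) (sym (second t yt≉0))))) ⟩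
        β - a · v t     ≈⟨ y-∙ (v t) ⟨
        y at t          ∎
        where
        open Hyperplane H′

        τ≉0 : ¬ τ ≈ 0#
        τ≉0 τ≈0 = nonzero λ i → trans (n′≋τa i) (trans (*-congʳ τ≈0) (zeroˡ (a i)))

        on-second : ∀ s → ¬ y at s ≈ 0# → ⟦ hyperplane ⟧ (v s) ⊎ ⟦ H′ ⟧ (v s) → τ * (a · v s) ≈ offset
        on-second s ys≉0 (inj₁ on)  = contradiction (on-face (v s) on) ys≉0
        on-second s ys≉0 (inj₂ on′) = begin
          τ * (a · v s)                     ≈⟨ *-distribˡ-sum τ (λ i → a i * v s i) ⟩
          sum (λ i → τ * (a i * v s i))     ≈⟨ sum-cong-≋ (λ i → trans (sym (*-assoc τ (a i) (v s i))) (*-congʳ (sym (n′≋τa i)))) ⟩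
          normal · v s                      ≈⟨ on′ ⟩
          offset                            ∎

        second : ∀ s → ¬ y at s ≈ 0# → τ * (a · v s) ≈ offset
        second s ys≉0 = on-second s ys≉0 (covers {v s} (v-vertex s))

  -- Dividing y by its one nonzero value on the vertices makes it 0/1-valued; `linear` with second
  -- coefficient 0 serves as the scaling.
  twoLevelOn : TwoLevel d P → TwoLevelOn S
  twoLevelOn twoLevel y Y = χ , (linear (inv (y at s₁)) y 0# y , realises value) ,
    λ {s} _ → zero-at s (y at s ≟ 0#) , at-zero s (y at s ≟ 0#)
    where
    s₁    = proj₁ (Facet.nonZero Y)
    ys₁≉0 = proj₂ (proj₂ (Facet.nonZero Y))

    χ : Fin f₀ → Bool
    χ s = not (does (y at s ≟ 0#))

    zero-at : ∀ s (zero? : Dec (y at s ≈ 0#)) → not (does zero?) ≡ false → y at s ≈ 0#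
    zero-at s (yes ys≈0) _ = ys≈0

    at-zero : ∀ s (zero? : Dec (y at s ≈ 0#)) → y at s ≈ 0# → not (does zero?) ≡ false
    at-zero s (yes _)    _    = ≡.refl
    at-zero s (no ys≉0) ys≈0 = contradiction ys≈0 ys≉0

    scaled : ∀ s (zero? : Dec (y at s ≈ 0#)) → inv (y at s₁) * y at s ≈ indicator (not (does zero?))
    scaled s (yes ys≈0) = trans (*-congˡ ys≈0) (zeroʳ _)
    scaled s (no ys≉0)  = trans (*-congˡ (two-valued Y twoLevel ys≉0 ys₁≉0))
      (trans (*-comm _ _) (*-inverseʳ ys₁≉0))

    value : ∀ s → linear (inv (y at s₁)) y 0# y at s ≈ indicator (χ s)
    value s = trans (linear-at (inv (y at s₁)) y 0# y s) (trans
      (solve 2 (λ t u → t :+ con (ℤ.+ 0) :* u := t) refl (inv (y at s₁) * y at s) (y at s))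
      (scaled s (y at s ≟ 0#)))

  -- Distinct vertices differ in some coordinate, and coordinates are functionals.
  vertices-separated : TwoLevel d P → AllPairs Separated S
  vertices-separated twoLevel = AllPairs.tabulate⁺ λ {s} {t} s≢t →
    separated (twoLevelOn twoLevel) (∈-allFin s) (∈-allFin t) λ same →
    s≢t (v-injective λ j → trans (sym (coordinate s j)) (trans (same (unit (suc j))) (coordinate t j)))
    where
    coordinate : ∀ s j → unit (suc j) at s ≈ v s j
    coordinate s j = unit-· (suc j) (homogenise (v s))

  -- Counting the facets of a 2-level polytope

  module FacetCount (twoLevel : TwoLevel d P) {f₁ : ℕ} (facets : HasCardinality (Facets d P) f₁) where

    facetSet : Fin f₁ → Subset d
    facetSet i = proj₁ (Bijection.to facets i)

    module F i = GivenFacet (facetSet i) (proj₂ (Bijection.to facets i))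

    Binary-facet : Fin f₁ → (Fin f₀ → Bool) → Set _
    Binary-facet i χ = Binary χ ×
      (∀ {s} → s ∈ S → (χ s ≡ false → F.y i at s ≈ 0#) × (F.y i at s ≈ 0# → χ s ≡ false))

    binary-facet : ∀ i → ∃ (Binary-facet i)
    binary-facet i = twoLevelOn twoLevel (F.y i) (F.facet i)

    χ : Fin f₁ → Fin f₀ → Bool
    χ i = proj₁ (binary-facet i)

    binary : ∀ i → Binary (χ i)
    binary i = proj₁ (proj₂ (binary-facet i))

    false⇒zero : ∀ i s → χ i s ≡ false → F.y i at s ≈ 0#
    false⇒zero i s = proj₁ (proj₂ (proj₂ (binary-facet i)) (∈-allFin s))

    zero⇒false : ∀ i s → F.y i at s ≈ 0# → χ i s ≡ false
    zero⇒false i s = proj₂ (proj₂ (proj₂ (binary-facet i)) (∈-allFin s))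

    nonConstant : ∀ i → NonConstant S (χ i)
    nonConstant i =
      (s , ∈-allFin s , is-true (χ i s) ≡.refl) ,
      (t , ∈-allFin t , zero⇒false i t (proj₂ (F.zero-vertex i)))
      where
      s = proj₁ (F.nonzero-vertex i)
      t = proj₁ (F.zero-vertex i)

      is-true : ∀ b → χ i s ≡ b → χ i s ≡ true
      is-true true  eq = eq
      is-true false eq = contradiction (false⇒zero i s eq) (proj₂ (F.nonzero-vertex i))

    -- A facet is determined by the vertices on it, because a functional vanishing at these vanishes
    -- on the whole facet.
    facet⊆ : ∀ i j → Agree S (χ i) (χ j) → ∀ {x} → facetSet i x → facetSet j x
    facet⊆ i j agree {x} x∈F = let x∈P , yx≈0 = F.F⇒ i x∈F in
      F.⇒F j x∈P (face-vanishes (F.y i) (F.y j) (F.y≥0 i)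
        (λ s ys≈0 → false⇒zero j s (≡.trans (≡.sym (agree (∈-allFin s))) (zero⇒false i s ys≈0))) x x∈P yx≈0)

    χ-differ : ∀ {i j} → i ≢ j → Differ S (χ i) (χ j)
    χ-differ {i} {j} i≢j agree = i≢j (Bijection.injective facets
      ((λ {x} → facet⊆ i j agree {x}) , (λ {x} → facet⊆ j i (λ s∈ → ≡.sym (agree s∈)) {x})))

    L : List (Fin f₀ → Bool)
    L = tabulate χ

    L-binaries : Binaries L
    L-binaries ψ∈ with i , ≡.refl ← ∈-tabulate⁻ ψ∈ = binary i

    functional-facet : ∀ i → Facet S (proj₁ (binary i))
    functional-facet i = facet-realised (F.facet i) (proj₂ (binary i)) (proj₂ (proj₂ (binary-facet i)))

    Complementary : Fin f₁ → Fin f₁ → Set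
    Complementary i j = Agree S (χ i) (not ∘ χ j)

    Complementary-sym : ∀ {i j} → Complementary i j → Complementary j i
    Complementary-sym {i} {j} complementary {s} s∈ = ≡.trans
      (≡.sym (Bool.not-involutive (χ j s))) (≡.cong not (≡.sym (complementary s∈)))

    opposite-facet : ∀ i j → Complementary i j → Facet S (linear 1# one (- 1#) (proj₁ (binary i)))
    opposite-facet i j complementary = facet-realised (F.facet j) (realises-not (proj₂ (binary i))) λ {s} s∈ →
      let χj≡ = ≡.trans (≡.sym (Bool.not-involutive (χ j s))) (≡.cong not (≡.sym (complementary s∈))) in
      (λ eq → false⇒zero j s (≡.trans χj≡ eq)) , (λ ys≈0 → ≡.trans (≡.sym χj≡) (zero⇒false j s ys≈0))

    bound : ℕ
    bound = d ℕ.* 2 ℕ.^ (d ℕ.+ 1)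

    complementary-bound : ∀ i j → Complementary i j →
      length (part (χ i) true S) ℕ.≤ length (part (χ i) false S) → length S ℕ.* length L ℕ.≤ bound
    complementary-bound i j complementary larger = doubled-bound d {length S₀} {length S} {length L} S≤2S₀ S₀L≤
      where
      S₀ : List (Fin f₀)
      S₀ = part (χ i) false S

      S≤2S₀ : length S ℕ.≤ 2 ℕ.* length S₀
      S≤2S₀ = ℕ.≤-trans (ℕ.≤-reflexive (length-part (χ i) false S)) (ℕ.≤-trans (ℕ.+-monoʳ-≤ (length S₀) larger)
        (ℕ.≤-reflexive (≡.cong (length S₀ ℕ.+_) (≡.sym (ℕ.+-identityʳ (length S₀))))))

      S₀L≤ : length S₀ ℕ.* length L ℕ.≤ d ℕ.* 2 ℕ.^ d
      S₀L≤ = scalar-product-bound d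
        (twoLevelOn-facet (proj₂ (binary i)) (functional-facet i) (twoLevelOn twoLevel))
        (rankAtMost-facet (proj₂ (binary i)) (functional-facet i) (rankAtMost-dimension S))
        (AllPairs.filter⁺ (λ s → χ i s Bool.≟ false) (vertices-separated twoLevel))
        L L-binaries (AllPairs.tabulate⁺ λ {k} {l} k≢l agree → χ-differ k≢l
          (opposite-facet-agree (proj₂ (binary i)) (functional-facet i) (opposite-facet i j complementary)
            (binary k) (binary l) (nonConstant k) (nonConstant l) agree))

    with-complementary : ∀ i j → Complementary i j → length S ℕ.* length L ℕ.≤ bound
    with-complementary i j complementary
      -- The vertices off one of the two facets are those on the other, so the larger facet has at
      -- least half of all vertices.
      with ℕ.≤-total (length (part (χ j) false S)) (length (part (χ i) false S))
    ... | inj₁ j≤i = complementary-bound i j complementary (ℕ.≤-trans (true≤false i j complementary) j≤i)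
      where
      true≤false : ∀ i j → Complementary i j → length (part (χ i) true S) ℕ.≤ length (part (χ j) false S)
      true≤false i j complementary =
        length-filter-mono-≤ (λ s → χ i s Bool.≟ true) (λ s → χ j s Bool.≟ false) S
          λ s∈ eq → ≡.trans (Complementary-sym {i} {j} complementary s∈) (≡.cong not eq)
    ... | inj₂ i≤j = complementary-bound j i (Complementary-sym {i} {j} complementary)
      (ℕ.≤-trans (length-filter-mono-≤ (λ s → χ j s Bool.≟ true) (λ s → χ i s Bool.≟ false) S
        λ s∈ eq → ≡.trans (complementary s∈) (≡.cong not eq)) i≤j)

    without-complementary : (∀ i j → ¬ Complementary i j) → length S ℕ.* length L ℕ.≤ bound
    without-complementary none = halved-bound d {length S} {length L} (ℕ.s≤s ℕ.z≤n) length-LL̄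
      (scalar-product-bound (suc d) (twoLevelOn twoLevel) (rankAtMost-dimension S)
        (vertices-separated twoLevel) (L ++ L̄) LL̄-binaries LL̄-differ)
      where
      L̄ : List (Fin f₀ → Bool)
      L̄ = tabulate λ i → not ∘ χ i

      length-LL̄ : length (L ++ L̄) ≡ length L ℕ.+ length L
      length-LL̄ = ≡.trans (length-++ L) (≡.cong (length L ℕ.+_)
        (≡.trans (length-tabulate (λ i → not ∘ χ i)) (≡.sym (length-tabulate χ))))

      LL̄-binaries : Binaries (L ++ L̄)
      LL̄-binaries ψ∈ with ∈-++⁻ L ψ∈
      ... | inj₁ ψ∈L = L-binaries ψ∈L
      ... | inj₂ ψ∈L̄ with i , ≡.refl ← ∈-tabulate⁻ ψ∈L̄ = binary-not (binary i)

      LL̄-differ : AllPairs (Differ S) (L ++ L̄)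
      LL̄-differ = AllPairs.++⁺ (AllPairs.tabulate⁺ χ-differ)
        (AllPairs.tabulate⁺ λ i≢j agree → χ-differ i≢j λ s∈ → Bool.not-injective (agree s∈))
        (All.tabulate⁺ λ i → All.tabulate⁺ λ j → none i j)

    product-bound : f₀ ℕ.* f₁ ℕ.≤ bound
    product-bound = ≡.subst₂ (λ m n → m ℕ.* n ℕ.≤ bound) {length S} {f₀} {length L} {f₁} (length-tabulate id) (length-tabulate χ) by-cases
      where
      by-cases : length S ℕ.* length L ℕ.≤ bound
      by-cases with any? (λ i → any? (λ j → agree? S (χ i) (not ∘ χ j)))
      ... | yes (i , j , complementary) = with-complementary i j complementary
      ... | no none = without-complementary λ i j complementary → none (i , j , complementary)

open import Data.Nat.Base using (_+_; _*_; _^_; _≤_)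

theorem2 : ∀ {c ℓ₁ ℓ₂} (ℝ : RealField c ℓ₁ ℓ₂) (let open Polytopes ℝ)
    (d : ℕ) → 1 ≤ d →
    (P : Subset d) → IsPolytope P → HasDimension P d → TwoLevel d P →
    (f₀ f₍d-1₎ : ℕ) → HasCardinality (Vertices P) f₀ → HasCardinality (Facets d P) f₍d-1₎ →
    f₀ * f₍d-1₎ ≤ d * 2 ^ (d + 1)
theorem2 ℝ (suc d) _ P isPolytope hasDimension twoLevel f₀ f₍d-1₎ vertices facets =
  FacetCount.product-bound twoLevel facets
  where open TwoLevelPolytope ℝ isPolytope hasDimension vertices
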